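{- For every integer $n \ge 100$, $\mathrm{wsat}_4(n, B_4) \ge \frac{6}{13}n - \frac{11}{13}$. Moreover, this bound is attained (i.e. $\mathrm{wsat}_4(n,B_4) = \frac{6n-11}{13}$) for every $n \ge 100$ with $n \equiv 4 \pmod{13}$.
   Context: A $4$-uniform hypergraph on vertex set $V$ is a set of $4$-element subsets (hyperedges) of $V$. The bow tie $B_4$ is the $4$-uniform hypergraph on $7$ vertices consisting of two hyperedges sharing exactly one vertex. A $4$-uniform hypergraph $G$ on $n$ vertices is $B_4$-semi-saturated if for every $4$-subset $S$ of $V(G)$ that is not a hyperedge of $G$, there is a hyperedge $A$ of $G$ with $|A \cap S| = 1$ (so adding $S$ creates a copy of $B_4$ containing $S$); $G$ itself need not be $B_4$-free. $\mathrm{wsat}_4(n, B_4)$ denotes the minimum number of hyperedges of an $n$-vertex $4$-uniform $B_4$-semi-saturated hypergraph. -}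

module Defs where

open import Data.Nat using (ℕ; _≡ᵇ_)
open import Data.Fin using (Fin)
open import Data.Fin.Subset using (Subset; ∣_∣; _∩_)
open import Data.List using (List; length)
open import Data.List.Relation.Unary.All using (All)
open import Data.List.Relation.Unary.Unique.Propositional using (Unique)
open import Data.List.Membership.Propositional using (_∈_; _∉_)
open import Data.Product using (Σ; _×_; ∃-syntax)
open import Relation.Binary.PropositionalEquality using (_≡_)

record Hypergraph4 (n : ℕ) : Set where
  field
    edges    : List (Subset n)
    distinct : Unique edges
    uniform  : All (λ e → ∣ e ∣ ≡ 4) edges

open Hypergraph4 public

size : ∀ {n} → Hypergraph4 n → ℕ
size G = length (edges G)

B4-semi-saturated : ∀ {n} → Hypergraph4 n → Set
B4-semi-saturated {n} G =
  (S : Subset n) → ∣ S ∣ ≡ 4 → S ∉ edges G →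
  ∃[ A ] (A ∈ edges G × ∣ A ∩ S ∣ ≡ 1)

{-# OPTIONS --safe #-}

-- Lower bound.  Every vertex distributes weight 24 among its edges: 24 if it has degree 1, 8 to each
-- edge if it has degree ≥ 3, and 12 to each edge if it has degree 2, except that an edge containing a
-- degree-1 vertex (a pendant edge) passes on s of these 12 to the other edge at a degree-2 vertex.
-- A 4-set that meets no edge in exactly one vertex (a closed set) must be an edge.  If two vertices u, v
-- of an edge link it to two pendant edges with degree-1 vertices p, q, then {p, u, v, q} is closed; so
-- at most one vertex of an edge is such a link, and with s = 4 its load is at most 52 = 24 · 13/6, unless
-- it contains twins, i.e. two vertices lying in the same edges.  Two disjoint pairs of twins form
-- a closed 4-set, so there are few such exceptions, of total excess at most 44 = 24 · 11/6.  An isolated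
-- vertex also rules out closed triples; then s = 3 gives loads of at most 51, and the gain of 1 per
-- edge pays for the at most three isolated vertices because n ≥ 100.
--
-- Sharpness.  Take one isolated edge and disjoint pieces with 13k vertices and 6k edges that have no
-- closed sets of size 1, 2 or 4.  Pieces with k = 4, 5, 6, verified by a search, give all k ≥ 8.

module Submission where

open import Defs
open import Data.Bool using (Bool; true; false; _∧_; _∨_; T; if_then_else_)
open import Data.Bool.ListAction using (any; all)
open import Data.Bool.Properties using (T-∧; T-∨; T-≡) renaming (_≟_ to _≟ᵇ_)
open import Data.Empty using (⊥-elim)
open import Data.Fin using (Fin; zero; suc; toℕ)
open import Data.Fin.Properties as Fin using (toℕ<n; toℕ-injective)
open import Data.Fin.Subset using (Subset; ∣_∣; _∩_; ⁅_⁆; _∪_; ⊥; ⊤)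
  renaming (_∈_ to _∈ₛ_; _∉_ to _∉ₛ_; _⊆_ to _⊆ₛ_)
open import Data.Fin.Subset.Properties
  using (_∈?_; ∉⊥; x∈⁅x⁆; x∈⁅y⁆⇒x≡y; x∈p∪q⁺; x∈p∪q⁻; p⊂q⇒∣p∣<∣q∣; ⊆-antisym; ∩-zeroˡ; ∣⊥∣≡0; ∩-identityˡ; ∣p∣≡n⇒p≡⊤)
open import Data.List using (List; []; _∷_; _++_; length; map; filter; foldr; allFin; concatMap; upTo)
import Data.List.Membership.DecPropositional as DecMembership
open import Data.List.Membership.Propositional using (_∈_; _∉_; find; lose)
open import Data.List.Membership.Propositional.Properties
  using (∈-map⁺; ∈-map⁻; ∈-∃++; ∈-upTo⁺; ∈-++⁺ˡ; ∈-++⁺ʳ; ∈-filter⁺; ∈-filter⁻; ∈-allFin)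
open import Data.List.Membership.Propositional.Properties.WithK using (unique∧set⇒bag)
open import Data.List.Properties
  using (length-map; map-∘; map-cong; map-++; length-++; length-tabulate; ++-identityʳ)
open import Data.List.Relation.Binary.BagAndSetEquality using (∼bag⇒↭)
open import Data.List.Relation.Binary.Permutation.Propositional
  using (_↭_; ↭-refl; ↭-trans; ↭-sym; prep; ↭⇒↭ₛ)
open import Data.List.Relation.Binary.Permutation.Propositional.Properties
  using (shift; ↭-length; ∈-resp-↭; ++⁺) renaming (map⁺ to ↭-map⁺)
import Data.List.Relation.Binary.Permutation.Setoid.Properties as ↭ₛ
open import Data.List.Relation.Unary.All as All using (All; []; _∷_; all?)
open import Data.List.Relation.Unary.All.Properties using (all⁺) renaming (++⁺ to All-++⁺; map⁺ to All-map⁺)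
open import Data.List.Relation.Unary.AllPairs using ([]; _∷_)
open import Data.List.Relation.Unary.Any as Any using (Any; here; there)
open import Data.List.Relation.Unary.Any.Properties using (any⁻)
open import Data.List.Relation.Unary.Unique.DecPropositional using (unique?)
open import Data.List.Relation.Unary.Unique.Propositional using (Unique)
open import Data.List.Relation.Unary.Unique.Propositional.Properties using (allFin⁺)
  renaming (map⁺ to Unique-map⁺; ++⁺ to Unique-++⁺; filter⁺ to Unique-filter⁺)
open import Data.Nat
open import Data.Nat.DivMod using (m≡m%n+[m/n]*n)
open import Data.Nat.ListAction using (sum)
open import Data.Nat.ListAction.Properties using (sum-++; sum-↭)
open import Data.Nat.Properties
open import Data.Nat.Tactic.RingSolver using (solve-∀)
open import Data.Product using (∃-syntax; _×_; _,_; proj₁; proj₂)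
open import Data.Sum as Sum using (_⊎_; inj₁; inj₂)
open import Data.Vec using ([]; _∷_; here; there; lookup; tabulate; splitAt) renaming (_++_ to _++ᵥ_)
open import Data.Vec.Properties
  using ([]=⇒lookup; lookup⇒[]=; lookup∘tabulate; zipWith-++; ++-injectiveˡ; ++-injectiveʳ; ≡-dec)
open import Function using (_∘_; _⇔_; mk⇔; Equivalence)
open import Relation.Binary.Definitions using (DecidableEquality)
open import Relation.Binary.PropositionalEquality
open import Relation.Nullary using (¬_; does; yes; no; contradiction)
open import Relation.Nullary.Decidable using (True; toWitness; from-yes; from-no)
open import Relation.Unary using (Decidable)

open import Algebra.Properties.CommutativeSemigroup +-commutativeSemigroup using (interchange; xy∙z≈xz∙y)

private variable
  A B : Set
  n : ℕ

-- Lists up to permutation, sums over lists, and member lists of subsets.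

Unique-resp-↭ : {xs ys : List A} → xs ↭ ys → Unique xs → Unique ys
Unique-resp-↭ {A} p = ↭ₛ.Unique-resp-↭ (setoid A) (↭⇒↭ₛ p)

extract : {x : A} {xs : List A} → x ∈ xs → ∃[ ys ] xs ↭ x ∷ ys
extract x∈xs with as , bs , refl ← ∈-∃++ x∈xs = as ++ bs , shift _ as bs

complement : {xs ys : List A} → Unique xs → (∀ {x} → x ∈ xs → x ∈ ys) → ∃[ zs ] ys ↭ xs ++ zs
complement {ys = ys} [] _ = ys , ↭-refl
complement {xs = x ∷ xs} (x∉xs ∷ xs!) xs⊆ys
  with ys′ , ys↭ ← extract (xs⊆ys (here refl))
  with zs , ys′↭ ← complement xs! (λ z∈xs → Any.tail (λ z≡x → All.lookup x∉xs z∈xs (sym z≡x))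
                                                    (∈-resp-↭ ys↭ (xs⊆ys (there z∈xs))))
  = zs , ↭-trans ys↭ (prep x ys′↭)

sumOf : (A → ℕ) → List A → ℕ
sumOf f xs = sum (map f xs)

sumOf-↭ : (f : A → ℕ) {xs ys : List A} → xs ↭ ys → sumOf f xs ≡ sumOf f ys
sumOf-↭ f p = sum-↭ (↭-map⁺ f p)

sumOf-++ : (f : A → ℕ) (xs ys : List A) → sumOf f (xs ++ ys) ≡ sumOf f xs + sumOf f ys
sumOf-++ f xs ys = trans (cong sum (map-++ f xs ys)) (sum-++ (map f xs) (map f ys))

count : (A → Bool) → List A → ℕ
count f = sumOf (λ x → if f x then 1 else 0)

count>0⇒∃ : (f : A → Bool) (xs : List A) → count f xs ≢ 0 → ∃[ x ] (x ∈ xs × f x ≡ true)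
count>0⇒∃ f []       ≢0 = contradiction refl ≢0
count>0⇒∃ f (x ∷ xs) ≢0 with f x in eq
... | true  = x , here refl , eq
... | false with y , y∈ , fy ← count>0⇒∃ f xs ≢0 = y , there y∈ , fy

members : Subset n → List (Fin n)
members []          = []
members (true  ∷ p) = zero ∷ map suc (members p)
members (false ∷ p) = map suc (members p)

length-members : (p : Subset n) → length (members p) ≡ ∣ p ∣
length-members []          = refl
length-members (true  ∷ p) = cong suc (trans (length-map suc (members p)) (length-members p))
length-members (false ∷ p) = trans (length-map suc (members p)) (length-members p)

∈-members⁺ : {p : Subset n} {x : Fin n} → x ∈ₛ p → x ∈ members p
∈-members⁺ {p = true  ∷ p} here       = here refl
∈-members⁺ {p = true  ∷ p} (there x∈) = there (∈-map⁺ suc (∈-members⁺ x∈))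
∈-members⁺ {p = false ∷ p} (there x∈) = ∈-map⁺ suc (∈-members⁺ x∈)

∈-members⁻ : {p : Subset n} {x : Fin n} → x ∈ members p → x ∈ₛ p
∈-members⁻ {p = true  ∷ p} (here refl) = here
∈-members⁻ {p = true  ∷ p} (there x∈) with y , y∈ , refl ← ∈-map⁻ suc x∈ = there (∈-members⁻ y∈)
∈-members⁻ {p = false ∷ p} x∈         with y , y∈ , refl ← ∈-map⁻ suc x∈ = there (∈-members⁻ y∈)

members-unique : (p : Subset n) → Unique (members p)
members-unique []          = []
members-unique (true  ∷ p) =
  All.tabulate (λ x∈ 0≡x → Fin.0≢1+n (trans 0≡x (proj₂ (proj₂ (∈-map⁻ suc x∈)))))
  ∷ Unique-map⁺ Fin.suc-injective (members-unique p)
members-unique (false ∷ p) = Unique-map⁺ Fin.suc-injective (members-unique p)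

unique-set⇒↭ : {xs ys : List A} → Unique xs → Unique ys → (∀ {x} → x ∈ xs ⇔ x ∈ ys) → xs ↭ ys
unique-set⇒↭ xs! ys! xs≈ys = ∼bag⇒↭ (unique∧set⇒bag xs! ys! xs≈ys)

∣∩∣≡count : (p q : Subset n) → ∣ p ∩ q ∣ ≡ count (lookup p) (members q)
∣∩∣≡count []          []          = refl
∣∩∣≡count (true  ∷ p) (true  ∷ q) =
  cong suc (trans (∣∩∣≡count p q) (cong sum (map-∘ (members q))))
∣∩∣≡count (true  ∷ p) (false ∷ q) = trans (∣∩∣≡count p q) (cong sum (map-∘ (members q)))
∣∩∣≡count (false ∷ p) (true  ∷ q) = trans (∣∩∣≡count p q) (cong sum (map-∘ (members q)))
∣∩∣≡count (false ∷ p) (false ∷ q) = trans (∣∩∣≡count p q) (cong sum (map-∘ (members q)))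

some-or-all : {P Q : A → Set} (xs : List A) → (∀ {x} → x ∈ xs → P x ⊎ Q x) →
              (∃[ x ] (x ∈ xs × P x)) ⊎ (∀ {x} → x ∈ xs → Q x)
some-or-all []       _ = inj₂ λ ()
some-or-all (x ∷ xs) f with f (here refl) | some-or-all xs (f ∘ there)
... | inj₁ px | _                   = inj₁ (x , here refl , px)
... | inj₂ _  | inj₁ (y , y∈ , py)  = inj₁ (y , there y∈ , py)
... | inj₂ qx | inj₂ qxs            = inj₂ λ { (here refl) → qx ; (there y∈) → qxs y∈ }

-- Estimates for sums over lists.

sumOf-mono : {f g : A → ℕ} (xs : List A) → (∀ {x} → x ∈ xs → f x ≤ g x) → sumOf f xs ≤ sumOf g xs
sumOf-mono []       _   = z≤n
sumOf-mono (x ∷ xs) f≤g = +-mono-≤ (f≤g (here refl)) (sumOf-mono xs (f≤g ∘ there))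

sumOf-const : (c : ℕ) (xs : List A) → sumOf (λ _ → c) xs ≡ length xs * c
sumOf-const c []       = refl
sumOf-const c (x ∷ xs) = cong (c +_) (sumOf-const c xs)

sumOf-≤ : {f : A → ℕ} {c : ℕ} (xs : List A) → (∀ {x} → x ∈ xs → f x ≤ c) → sumOf f xs ≤ length xs * c
sumOf-≤ {c = c} xs f≤c = ≤-trans (sumOf-mono xs f≤c) (≤-reflexive (sumOf-const c xs))

sumOf-+ : (f g : A → ℕ) (xs : List A) → sumOf (λ x → f x + g x) xs ≡ sumOf f xs + sumOf g xs
sumOf-+ f g []       = refl
sumOf-+ f g (x ∷ xs) = trans (cong (f x + g x +_) (sumOf-+ f g xs)) (interchange (f x) (g x) _ _)

sumOf-swap : (f : A → B → ℕ) (xs : List A) (ys : List B) →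
             sumOf (λ x → sumOf (f x) ys) xs ≡ sumOf (λ y → sumOf (λ x → f x y) xs) ys
sumOf-swap f []       ys = sym (trans (sumOf-const 0 ys) (*-zeroʳ (length ys)))
sumOf-swap f (x ∷ xs) ys = trans (cong (sumOf (f x) ys +_) (sumOf-swap f xs ys)) (sym (sumOf-+ (f x) _ ys))

sumOf-filter : {P : A → Set} (P? : Decidable P) (f : A → ℕ) (xs : List A) →
               sumOf f (filter P? xs) ≡ sumOf (λ x → if does (P? x) then f x else 0) xs
sumOf-filter P? f []       = refl
sumOf-filter P? f (x ∷ xs) with does (P? x)
... | true  = cong (f x +_) (sumOf-filter P? f xs)
... | false = sumOf-filter P? f xs

-- Since `xs` has no repetitions, each exceptional `x` uses up an occurrence of its own in `L`, so
-- the surplus `h` is charged at most once per entry. Entries of `L` left over only weaken the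
-- bound.
sumOf-except : {f h : A → ℕ} {t : ℕ} (L : List A) {xs : List A} → Unique xs →
               (∀ {x} → x ∈ xs → f x ≤ t ⊎ (x ∈ L × f x ≤ t + h x)) →
               sumOf f xs ≤ length xs * t + sumOf h L
sumOf-except L [] _ = z≤n
sumOf-except {f = f} {h} {t} L {x ∷ xs} (x∉ ∷ xs!) bound with bound (here refl)
... | inj₁ fx≤t = begin
  f x + sumOf f xs                   ≤⟨ +-mono-≤ fx≤t (sumOf-except L xs! (bound ∘ there)) ⟩
  t + (length xs * t + sumOf h L)    ≡⟨ +-assoc t _ _ ⟨
  t + length xs * t + sumOf h L      ∎
  where open ≤-Reasoning
... | inj₂ (x∈L , fx≤) with L′ , L↭ ← extract x∈L = begin
  f x + sumOf f xs                            ≤⟨ +-mono-≤ fx≤ (sumOf-except L′ xs! bound′) ⟩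
  t + h x + (length xs * t + sumOf h L′)      ≡⟨ interchange t (h x) _ _ ⟩
  t + length xs * t + sumOf h (x ∷ L′)        ≡⟨ cong (t + length xs * t +_) (sumOf-↭ h L↭) ⟨
  t + length xs * t + sumOf h L               ∎
  where
  open ≤-Reasoning
  bound′ : ∀ {y} → y ∈ xs → f y ≤ t ⊎ (y ∈ L′ × f y ≤ t + h y)
  bound′ y∈ = Sum.map₂ (λ (y∈L , fy≤) →
    Any.tail (λ y≡x → All.lookup x∉ y∈ (sym y≡x)) (∈-resp-↭ L↭ y∈L) , fy≤) (bound (there y∈))

-- If no later element is hot, the first hot one pays the surplus `s` once; otherwise the two are
-- returned as a pair, to be recognised as twins later.
sumOf-one-hot : {f : A → ℕ} {H : A → Set} {b s : ℕ} {xs : List A} → Unique xs →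
                (∀ {x} → x ∈ xs → (H x × f x ≤ b + s) ⊎ f x ≤ b) →
                (∃[ x ] ∃[ y ] (x ≢ y × x ∈ xs × y ∈ xs × H x × H y)) ⊎ sumOf f xs ≤ length xs * b + s
sumOf-one-hot [] _ = inj₂ z≤n
sumOf-one-hot {f = f} {b = b} {s} {x ∷ xs} (x∉ ∷ xs!) hot with hot (here refl)
... | inj₂ fx≤b = Sum.map
  (λ (y , z , y≢z , y∈ , z∈ , hs) → y , z , y≢z , there y∈ , there z∈ , hs)
  (λ rest → ≤-trans (+-mono-≤ fx≤b rest) (≤-reflexive (sym (+-assoc b _ s))))
  (sumOf-one-hot xs! (hot ∘ there))
... | inj₁ (Hx , fx≤) with some-or-all xs (hot ∘ there)
...   | inj₁ (y , y∈ , Hy , _) = inj₁ (x , y , All.lookup x∉ y∈ , here refl , there y∈ , Hx , Hy)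
...   | inj₂ cold = inj₂ (≤-trans (+-mono-≤ fx≤ (sumOf-≤ xs cold)) (≤-reflexive (xy∙z≈xz∙y b s _)))

count≡1⇒lonely : (f : A → Bool) (xs : List A) → count f xs ≡ 1 →
                 ∃[ x ] (x ∈ xs × f x ≡ true × (∀ {y} → y ∈ xs → f y ≡ true → y ≡ x))
count≡1⇒lonely f (x ∷ xs) c with f x in fx
... | true  = x , here refl , fx , λ
  { (here refl) _  → refl
  ; (there y∈)  fy → contradiction (trans (cong (if_then 1 else 0) (sym fy)) (count-zero xs (suc-injective c) y∈)) λ () }
  where
  count-zero : ∀ xs → count f xs ≡ 0 → ∀ {y} → y ∈ xs → (if f y then 1 else 0) ≡ 0
  count-zero (z ∷ zs) c₀ (here refl) = m+n≡0⇒m≡0 _ c₀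
  count-zero (z ∷ zs) c₀ (there y∈)  = count-zero zs (m+n≡0⇒n≡0 (if f z then 1 else 0) c₀) y∈
... | false with y , y∈ , fy , lonely ← count≡1⇒lonely f xs c = y , there y∈ , fy , λ
  { (here refl) fx′ → contradiction (trans (sym fx) fx′) λ ()
  ; (there z∈)  fz  → lonely z∈ fz }

fromList : List (Fin n) → Subset n
fromList = foldr (λ x → ⁅ x ⁆ ∪_) ⊥

∈-fromList⁺ : {x : Fin n} {xs : List (Fin n)} → x ∈ xs → x ∈ₛ fromList xs
∈-fromList⁺ (here refl) = x∈p∪q⁺ (inj₁ (x∈⁅x⁆ _))
∈-fromList⁺ (there x∈)  = x∈p∪q⁺ (inj₂ (∈-fromList⁺ x∈))

∈-fromList⁻ : {x : Fin n} (xs : List (Fin n)) → x ∈ₛ fromList xs → x ∈ xs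
∈-fromList⁻ []       x∈ = contradiction x∈ ∉⊥
∈-fromList⁻ (y ∷ xs) x∈ with x∈p∪q⁻ ⁅ y ⁆ _ x∈
... | inj₁ x∈y  = here (x∈⁅y⁆⇒x≡y y x∈y)
... | inj₂ x∈xs = there (∈-fromList⁻ xs x∈xs)

members-fromList : {xs : List (Fin n)} → Unique xs → members (fromList xs) ↭ xs
members-fromList {xs = xs} xs! = unique-set⇒↭ (members-unique (fromList xs)) xs!
  (mk⇔ (∈-fromList⁻ xs ∘ ∈-members⁻) (∈-members⁺ ∘ ∈-fromList⁺))

_≟ₛ_ : DecidableEquality (Subset n)
_≟ₛ_ = ≡-dec _≟ᵇ_

⊆∧∣≡∣⇒≡ : {p q : Subset n} → p ⊆ₛ q → ∣ p ∣ ≡ ∣ q ∣ → p ≡ q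
⊆∧∣≡∣⇒≡ {p = p} {q} p⊆q ∣p∣≡∣q∣ = ⊆-antisym p⊆q q⊆p
  where
  q⊆p : q ⊆ₛ p
  q⊆p {x} x∈q with x ∈? p
  ... | yes x∈p = x∈p
  ... | no  x∉p = contradiction ∣p∣≡∣q∣ (<⇒≢ (p⊂q⇒∣p∣<∣q∣ (p⊆q , x , x∈q , x∉p)))

-- The lower bound

module LowerBound (G : Hypergraph4 n) (semi-saturated : B4-semi-saturated G) where

  E : List (Subset n)
  E = edges G

  open DecMembership (_≟ₛ_ {n}) using () renaming (_∈?_ to _∈ᴱ?_)

  -- Edges as 4-sets, and closed 4-sets.

  ∣e∣≡4 : ∀ {e} → e ∈ E → ∣ e ∣ ≡ 4
  ∣e∣≡4 = All.lookup (uniform G)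

  ∣members∣≡4 : ∀ {e} → e ∈ E → length (members e) ≡ 4
  ∣members∣≡4 {e} e∈E = trans (length-members e) (∣e∣≡4 e∈E)

  complete-members : ∀ {e xs} → e ∈ E → Unique xs → All (_∈ₛ e) xs →
                     ∃[ ys ] (members e ↭ xs ++ ys × length xs + length ys ≡ 4)
  complete-members {xs = xs} e∈E xs! xs⊆e =
    let ys , e↭ = complement xs! (λ x∈ → ∈-members⁺ (All.lookup xs⊆e x∈))
    in ys , e↭ , trans (sym (length-++ xs)) (trans (sym (↭-length e↭)) (∣members∣≡4 e∈E))

  two-more-members : ∀ {e u v} → e ∈ E → u ≢ v → u ∈ₛ e → v ∈ₛ e →
                     ∃[ x ] ∃[ y ] members e ↭ u ∷ v ∷ x ∷ y ∷ []
  two-more-members e∈E u≢v u∈e v∈e with complete-members e∈E ((u≢v ∷ []) ∷ [] ∷ []) (u∈e ∷ v∈e ∷ [])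
  ... | x ∷ y ∷ [] , e↭ , _ = x , y , e↭

  four-members : ∀ {e u v x y} → e ∈ E → Unique (u ∷ v ∷ x ∷ y ∷ []) → All (_∈ₛ e) (u ∷ v ∷ x ∷ y ∷ []) →
                 members e ↭ u ∷ v ∷ x ∷ y ∷ []
  four-members e∈E ! ⊆e with complete-members e∈E ! ⊆e
  ... | [] , e↭ , _ = e↭

  -- Semi-saturation read backwards: if `fromList xs` were not an edge, some edge would meet it in
  -- one vertex only, and `closed` names a second one. The conclusion keeps containment alone, since
  -- edges are only compared through single vertices.
  closed⇒edge : (xs : List (Fin n)) → Unique xs → length xs ≡ 4 →
                (∀ {A x} → A ∈ E → x ∈ xs → x ∈ₛ A → ∃[ y ] (y ∈ xs × y ≢ x × y ∈ₛ A)) →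
                ∃[ e ] (e ∈ E × (∀ {x} → x ∈ xs → x ∈ₛ e))
  closed⇒edge xs xs! ∣xs∣≡4 closed with fromList xs ∈ᴱ? E
  ... | yes S∈E = fromList xs , S∈E , ∈-fromList⁺
  ... | no  S∉E
    with A , A∈E , hit ← semi-saturated (fromList xs)
           (trans (sym (length-members (fromList xs))) (trans (↭-length (members-fromList xs!)) ∣xs∣≡4)) S∉E
    with x , x∈ , Ax , lonely ← count≡1⇒lonely (lookup A) xs
           (trans (sym (sumOf-↭ _ (members-fromList xs!))) (trans (sym (∣∩∣≡count A (fromList xs))) hit))
    with y , y∈ , y≢x , y∈A ← closed A∈E x∈ (lookup⇒[]= x A Ax)
    = contradiction (lonely y∈ ([]=⇒lookup y∈A)) y≢x

  -- Vertices of degree 0, 1 and 2, and twins.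

  Isolated : Fin n → Set
  Isolated v = ∀ {A} → A ∈ E → v ∉ₛ A

  record Only₁ (v : Fin n) (e : Subset n) : Set where
    constructor only₁
    field
      e∈E  : e ∈ E
      v∈e  : v ∈ₛ e
      only : ∀ {A} → A ∈ E → v ∈ₛ A → A ≡ e

  record Only₂ (v : Fin n) (e f : Subset n) : Set where
    constructor only₂
    field
      e∈E  : e ∈ E
      f∈E  : f ∈ E
      e≢f  : e ≢ f
      v∈e  : v ∈ₛ e
      v∈f  : v ∈ₛ f
      only : ∀ {A} → A ∈ E → v ∈ₛ A → A ≡ e ⊎ A ≡ f

  Only₂-sym : ∀ {v e f} → Only₂ v e f → Only₂ v f e
  Only₂-sym (only₂ e∈ f∈ e≢f v∈e v∈f only) = only₂ f∈ e∈ (e≢f ∘ sym) v∈f v∈e (λ A∈ v∈A → Sum.swap (only A∈ v∈A))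

  Only₁-≢ : ∀ {x y e f} → f ≢ e → Only₁ x e → Only₁ y f → x ≢ y
  Only₁-≢ f≢e x₁ y₁ refl = f≢e (Only₁.only x₁ (Only₁.e∈E y₁) (Only₁.v∈e y₁))

  Only₁-Only₂-≢ : ∀ {p v e f g} → Only₁ p e → Only₂ v f g → p ≢ v
  Only₁-Only₂-≢ p v refl = Only₂.e≢f v
    (trans (Only₁.only p (Only₂.e∈E v) (Only₂.v∈e v)) (sym (Only₁.only p (Only₂.f∈E v) (Only₂.v∈f v))))

  Twins : Fin n → Fin n → Set
  Twins u v = ∀ {A} → A ∈ E → u ∈ₛ A ⇔ v ∈ₛ A

  Only₁⇒Twins : ∀ {u v e} → Only₁ u e → Only₁ v e → Twins u v
  Only₁⇒Twins u v A∈E = mk⇔ (λ u∈A → subst (_ ∈ₛ_) (sym (Only₁.only u A∈E u∈A)) (Only₁.v∈e v))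
                            (λ v∈A → subst (_ ∈ₛ_) (sym (Only₁.only v A∈E v∈A)) (Only₁.v∈e u))

  Only₂-⊆ : ∀ {u v e f A} → Only₂ u e f → Only₂ v e f → A ∈ E → u ∈ₛ A → v ∈ₛ A
  Only₂-⊆ u v A∈E u∈A with Only₂.only u A∈E u∈A
  ... | inj₁ refl = Only₂.v∈e v
  ... | inj₂ refl = Only₂.v∈f v

  Only₂⇒Twins : ∀ {u v e f} → Only₂ u e f → Only₂ v e f → Twins u v
  Only₂⇒Twins u v A∈E = mk⇔ (Only₂-⊆ u v A∈E) (Only₂-⊆ v u A∈E)

  -- An edge contains both or neither vertex of each pair, so it never meets the four vertices in
  -- exactly one.
  twin-pairs⇒edge : ∀ {u v a b} → Unique (u ∷ v ∷ a ∷ b ∷ []) → Twins u v → Twins a b →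
                    ∃[ e ] (e ∈ E × u ∈ₛ e × a ∈ₛ e × b ∈ₛ e)
  twin-pairs⇒edge {u} {v} {a} {b} !@((u≢v ∷ _) ∷ _ ∷ (a≢b ∷ _) ∷ _) uv ab
    with e , e∈E , ∈e ← closed⇒edge (u ∷ v ∷ a ∷ b ∷ []) ! refl (λ
      { A∈ (here refl)                         u∈A → v , there (here refl) , u≢v ∘ sym , Equivalence.to (uv A∈) u∈A
      ; A∈ (there (here refl))                 v∈A → u , here refl , u≢v , Equivalence.from (uv A∈) v∈A
      ; A∈ (there (there (here refl)))         a∈A → b , there (there (there (here refl))) , a≢b ∘ sym , Equivalence.to (ab A∈) a∈A
      ; A∈ (there (there (there (here refl)))) b∈A → a , there (there (here refl)) , a≢b , Equivalence.from (ab A∈) b∈A })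
    = e , e∈E , ∈e (here refl) , ∈e (there (there (here refl))) , ∈e (there (there (there (here refl))))

  -- Isolated vertices `y` and `z` are twins as well, lying in no edge at all; together with `u` and
  -- `v` they would form an edge through `y`.
  two-isolated⇒¬twins : ∀ {y z u v e} → y ≢ z → Isolated y → Isolated z → u ≢ v → e ∈ E → u ∈ₛ e → ¬ Twins u v
  two-isolated⇒¬twins {y} {z} {u} {v} {e} y≢z iy iz u≢v e∈E u∈e uv =
    let v∈e = Equivalence.to (uv e∈E) u∈e
        g , g∈E , y∈g , _ = twin-pairs⇒edge
          ((y≢z ∷ differ iy u∈e ∷ differ iy v∈e ∷ []) ∷ (differ iz u∈e ∷ differ iz v∈e ∷ []) ∷ (u≢v ∷ []) ∷ [] ∷ [])
          (λ A∈ → mk⇔ (λ y∈A → contradiction y∈A (iy A∈)) (λ z∈A → contradiction z∈A (iz A∈))) uv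
    in iy g∈E y∈g
    where
    differ : ∀ {z w} → Isolated z → w ∈ₛ e → z ≢ w
    differ iz w∈e refl = iz e∈E w∈e

  ¬four-isolated : ∀ {a b c d} → Unique (a ∷ b ∷ c ∷ d ∷ []) → ¬ All Isolated (a ∷ b ∷ c ∷ d ∷ [])
  ¬four-isolated ! is =
    let e , e∈E , ∈e = closed⇒edge _ ! refl (λ A∈ x∈ x∈A → contradiction x∈A (All.lookup is x∈ A∈))
    in All.lookup is (here refl) e∈E (∈e (here refl))

  -- Otherwise {p, u, v, q} would be a closed set that is not an edge.
  pendant-path-unique : ∀ {u v p q e f g} → u ≢ v → Only₂ u e f → Only₂ v e g → Only₁ p f → Only₁ q g → f ≡ g
  pendant-path-unique {u} {v} {p} {q} {e} {f} {g} u≢v u₂ v₂ p₁ q₁ with f ≟ₛ g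
  ... | yes f≡g = f≡g
  ... | no  f≢g =
    let h , h∈E , ∈h = closed⇒edge (p ∷ u ∷ v ∷ q ∷ [])
          ((Only₁-Only₂-≢ p₁ u₂ ∷ Only₁-Only₂-≢ p₁ v₂ ∷ p≢q ∷ []) ∷ (u≢v ∷ (Only₁-Only₂-≢ q₁ u₂ ∘ sym) ∷ [])
            ∷ ((Only₁-Only₂-≢ q₁ v₂ ∘ sym) ∷ []) ∷ [] ∷ [])
          refl λ
          { A∈ (here refl)                 p∈A → u , there (here refl) , Only₁-Only₂-≢ p₁ u₂ ∘ sym
                                               , subst (u ∈ₛ_) (sym (Only₁.only p₁ A∈ p∈A)) (Only₂.v∈f u₂)
          ; A∈ (there (here refl))         u∈A → from-u (Only₂.only u₂ A∈ u∈A)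
          ; A∈ (there (there (here refl))) v∈A → from-v (Only₂.only v₂ A∈ v∈A)
          ; A∈ (there (there (there (here refl)))) q∈A → v , there (there (here refl)) , Only₁-Only₂-≢ q₁ v₂ ∘ sym
                                               , subst (v ∈ₛ_) (sym (Only₁.only q₁ A∈ q∈A)) (Only₂.v∈f v₂) }
    in trans (sym (Only₁.only p₁ h∈E (∈h (here refl)))) (Only₁.only q₁ h∈E (∈h (there (there (there (here refl))))))
    where
    p≢q : p ≢ q
    p≢q = Only₁-≢ (f≢g ∘ sym) p₁ q₁
    from-u : ∀ {A} → A ≡ e ⊎ A ≡ f → ∃[ y ] (y ∈ p ∷ u ∷ v ∷ q ∷ [] × y ≢ u × y ∈ₛ A)
    from-u (inj₁ refl) = v , there (there (here refl)) , u≢v ∘ sym , Only₂.v∈e v₂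
    from-u (inj₂ refl) = p , here refl , Only₁-Only₂-≢ p₁ u₂ , Only₁.v∈e p₁
    from-v : ∀ {A} → A ≡ e ⊎ A ≡ g → ∃[ y ] (y ∈ p ∷ u ∷ v ∷ q ∷ [] × y ≢ v × y ∈ₛ A)
    from-v (inj₁ refl) = u , there (here refl) , u≢v , Only₂.v∈e u₂
    from-v (inj₂ refl) = q , there (there (there (here refl))) , Only₁-Only₂-≢ q₁ v₂ , Only₁.v∈e q₁

  -- Otherwise {z, p, v, q} would be a closed set that is not an edge.
  isolated⇒no-adjacent-pendants : ∀ {z v p q e f} → Isolated z → Only₂ v e f → Only₁ p e → ¬ Only₁ q f
  isolated⇒no-adjacent-pendants {z} {v} {p} {q} {e} {f} iz v₂ p₁ q₁ =
    let h , h∈E , ∈h = closed⇒edge (z ∷ p ∷ v ∷ q ∷ [])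
          ((differ (Only₁.e∈E p₁) (Only₁.v∈e p₁) ∷ differ (Only₂.e∈E v₂) (Only₂.v∈e v₂)
              ∷ differ (Only₁.e∈E q₁) (Only₁.v∈e q₁) ∷ [])
            ∷ (Only₁-Only₂-≢ p₁ v₂ ∷ p≢q ∷ []) ∷ ((Only₁-Only₂-≢ q₁ v₂ ∘ sym) ∷ []) ∷ [] ∷ [])
          refl λ
          { A∈ (here refl)                 z∈A → contradiction z∈A (iz A∈)
          ; A∈ (there (here refl))         p∈A → v , there (there (here refl)) , Only₁-Only₂-≢ p₁ v₂ ∘ sym
                                               , subst (v ∈ₛ_) (sym (Only₁.only p₁ A∈ p∈A)) (Only₂.v∈e v₂)
          ; A∈ (there (there (here refl))) v∈A → from-v (Only₂.only v₂ A∈ v∈A)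
          ; A∈ (there (there (there (here refl)))) q∈A → v , there (there (here refl)) , Only₁-Only₂-≢ q₁ v₂ ∘ sym
                                               , subst (v ∈ₛ_) (sym (Only₁.only q₁ A∈ q∈A)) (Only₂.v∈f v₂) }
    in iz h∈E (∈h (here refl))
    where
    differ : ∀ {w g} → g ∈ E → w ∈ₛ g → z ≢ w
    differ g∈E w∈g refl = iz g∈E w∈g
    p≢q : p ≢ q
    p≢q = Only₁-≢ (Only₂.e≢f v₂ ∘ sym) p₁ q₁
    from-v : ∀ {A} → A ≡ e ⊎ A ≡ f → ∃[ y ] (y ∈ z ∷ p ∷ v ∷ q ∷ [] × y ≢ v × y ∈ₛ A)
    from-v (inj₁ refl) = p , there (here refl) , Only₁-Only₂-≢ p₁ v₂ , Only₁.v∈e p₁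
    from-v (inj₂ refl) = q , there (there (there (here refl))) , Only₁-Only₂-≢ q₁ v₂ , Only₁.v∈e q₁

  -- Incidence lists and degrees.

  incident : Fin n → List (Subset n)
  incident v = filter (v ∈?_) E

  incident-unique : ∀ v → Unique (incident v)
  incident-unique v = Unique-filter⁺ (v ∈?_) (distinct G)

  -- Expressed by the length of an incidence list, which makes it decidable; `Pendant⇒Only₁` and
  -- `Only₁⇒Pendant` translate to the form that the closed-set arguments use.
  Pendant : Subset n → Set
  Pendant e = Any (λ v → length (incident v) ≡ 1) (members e)

  pendant? : Decidable Pendant
  pendant? e = Any.any? (λ v → length (incident v) ≟ 1) (members e)

  module _ {v : Fin n} where

    ∈-incident⁺ : ∀ {A L} → incident v ≡ L → A ∈ E → v ∈ₛ A → A ∈ L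
    ∈-incident⁺ refl A∈E v∈A = ∈-filter⁺ (v ∈?_) A∈E v∈A

    ∈-incident⁻ : ∀ {A L} → incident v ≡ L → A ∈ L → A ∈ E × v ∈ₛ A
    ∈-incident⁻ refl A∈ = ∈-filter⁻ (v ∈?_) {xs = E} A∈

    incident-[]⇒Isolated : incident v ≡ [] → Isolated v
    incident-[]⇒Isolated eq A∈E v∈A with () ← ∈-incident⁺ eq A∈E v∈A

    incident-[e]⇒Only₁ : ∀ {e} → incident v ≡ e ∷ [] → Only₁ v e
    incident-[e]⇒Only₁ eq = let e∈E , v∈e = ∈-incident⁻ eq (here refl) in
      only₁ e∈E v∈e λ A∈ v∈A → case (∈-incident⁺ eq A∈ v∈A)
      where
      case : ∀ {A e} → A ∈ e ∷ [] → A ≡ e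
      case (here eq) = eq

    incident-[e,f]⇒Only₂ : ∀ {e f} → incident v ≡ e ∷ f ∷ [] → Only₂ v e f
    incident-[e,f]⇒Only₂ {e} {f} eq = 
      let e∈E , v∈e = ∈-incident⁻ eq (here refl)
          f∈E , v∈f = ∈-incident⁻ eq (there (here refl))
      in only₂ e∈E f∈E (e≢f (subst Unique eq (incident-unique v))) v∈e v∈f (λ A∈ v∈A → case (∈-incident⁺ eq A∈ v∈A))
      where
      e≢f : Unique (e ∷ f ∷ []) → e ≢ f
      e≢f ((e≢f ∷ []) ∷ _) = e≢f
      case : ∀ {A} → A ∈ e ∷ f ∷ [] → A ≡ e ⊎ A ≡ f
      case (here eq)         = inj₁ eq
      case (there (here eq)) = inj₂ eq

    Only₁⇒∣incident∣≡1 : ∀ {e} → Only₁ v e → length (incident v) ≡ 1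
    Only₁⇒∣incident∣≡1 (only₁ e∈ v∈e only) with incident v in eq | incident-unique v
    ... | []        | _ with () ← ∈-incident⁺ eq e∈ v∈e
    ... | _ ∷ []    | _ = refl
    ... | f ∷ g ∷ _ | (f≢g ∷ _) ∷ _ =
      let f∈E , v∈f = ∈-incident⁻ eq (here refl)
          g∈E , v∈g = ∈-incident⁻ eq (there (here refl))
      in contradiction (trans (only f∈E v∈f) (sym (only g∈E v∈g))) f≢g

  Pendant⇒Only₁ : ∀ {e} → e ∈ E → Pendant e → ∃[ p ] Only₁ p e
  Pendant⇒Only₁ {e} e∈E pe with p , p∈ , one ← find pe with incident p in eq
  ... | f ∷ [] with ∈-incident⁺ eq e∈E (∈-members⁻ p∈)
  ...   | here refl = p , incident-[e]⇒Only₁ eq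

  Only₁⇒Pendant : ∀ {p e} → Only₁ p e → Pendant e
  Only₁⇒Pendant p₁ = lose (∈-members⁺ (Only₁.v∈e p₁)) (Only₁⇒∣incident∣≡1 p₁)

  isolated? : Decidable (λ v → incident v ≡ [])
  isolated? v with incident v
  ... | []    = yes refl
  ... | _ ∷ _ = no λ ()

  isolates : List (Fin n)
  isolates = filter isolated? (allFin n)

  isolates-isolated : All Isolated isolates
  isolates-isolated = All.tabulate λ v∈ → incident-[]⇒Isolated (proj₂ (∈-filter⁻ isolated? {xs = allFin n} v∈))

  isolates-unique : Unique isolates
  isolates-unique = Unique-filter⁺ isolated? (allFin⁺ n)

  -- Junk value e unless v has degree 2.
  other : Fin n → Subset n → Subset n
  other v e with incident v
  ... | f ∷ g ∷ [] = if does (e ≟ₛ f) then g else f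
  ... | _          = e

  other-Only₂ : ∀ {v e f} → Only₂ v e f → other v e ≡ f
  other-Only₂ {v} {e} {f} v₂ with incident v in eq | incident-unique v
  ... | [] | _ with () ← ∈-incident⁺ eq (Only₂.e∈E v₂) (Only₂.v∈e v₂)
  ... | g ∷ [] | _ = contradiction refl (Only₁-Only₂-≢ (incident-[e]⇒Only₁ eq) v₂)
  ... | g ∷ h ∷ [] | _ = result
    where
    v₂′ = incident-[e,f]⇒Only₂ eq
    result : (if does (e ≟ₛ g) then h else g) ≡ f
    result with e ≟ₛ g
    ... | yes refl = Sum.[ (λ h≡e → contradiction (sym h≡e) (Only₂.e≢f v₂′)) , (λ h≡f → h≡f) ]
                         (Only₂.only v₂ (Only₂.f∈E v₂′) (Only₂.v∈f v₂′))
    ... | no  e≢g = Sum.[ (λ g≡e → contradiction (sym g≡e) e≢g) , (λ g≡f → g≡f) ]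
                         (Only₂.only v₂ (Only₂.e∈E v₂′) (Only₂.v∈e v₂′))
  ... | g ∷ h ∷ i ∷ _ | (g≢h ∷ g≢i ∷ _) ∷ (h≢i ∷ _) ∷ _ = impossible
    where
    locate : ∀ {A} → A ∈ g ∷ h ∷ i ∷ _ → A ≡ e ⊎ A ≡ f
    locate A∈ = let A∈E , v∈A = ∈-incident⁻ eq A∈ in Only₂.only v₂ A∈E v∈A
    impossible : {X : Set} → X
    impossible with locate (here refl) | locate (there (here refl)) | locate (there (there (here refl)))
    ... | inj₁ ge | inj₁ he | _       = contradiction (trans ge (sym he)) g≢h
    ... | inj₁ ge | inj₂ _  | inj₁ ie = contradiction (trans ge (sym ie)) g≢i
    ... | inj₁ _  | inj₂ hf | inj₂ jf = contradiction (trans hf (sym jf)) h≢i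
    ... | inj₂ _  | inj₁ he | inj₁ ie = contradiction (trans he (sym ie)) h≢i
    ... | inj₂ gf | inj₁ _  | inj₂ jf = contradiction (trans gf (sym jf)) g≢i
    ... | inj₂ gf | inj₂ hf | _       = contradiction (trans gf (sym hf)) g≢h

  -- Weights and double counting.

  module Weights (s : ℕ) (s≤4 : s ≤ 4) where

    gift : Subset n → ℕ
    gift e = if does (pendant? e) then s else 0

    -- What `e` receives from a degree-2 vertex that also lies in `f`: half of 24, less the gift
    -- that `e` makes, plus the gift from `f`. Between two pendant edges the gifts cancel.
    share : Subset n → Subset n → ℕ
    share e f = (12 ∸ gift e) + gift f

    -- Meaningful only for `v ∈ₛ e`; for other edges the value is junk, and the sums run over
    -- incident pairs only. The test against `f` decides which of the two edges is `e`.
    weight : Fin n → Subset n → ℕ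
    weight v e with incident v
    ... | []          = 0
    ... | _ ∷ []      = 24
    ... | f ∷ g ∷ []  = if does (e ≟ₛ f) then share f g else share g f
    ... | _ ∷ _ ∷ _ ∷ _ = 8

    gift≤s : ∀ e → gift e ≤ s
    gift≤s e with pendant? e
    ... | yes _ = ≤-refl
    ... | no  _ = z≤n

    gift-pendant : ∀ e → Pendant e → gift e ≡ s
    gift-pendant e pe with pendant? e
    ... | yes _  = refl
    ... | no ¬pe = contradiction pe ¬pe

    gift-¬pendant : ∀ e → ¬ Pendant e → gift e ≡ 0
    gift-¬pendant e ¬pe with pendant? e
    ... | yes pe = contradiction pe ¬pe
    ... | no  _  = refl

    -- The gifts cancel. Subtraction is truncated, so `12 ∸ gift e` is first replaced by an `a` with
    -- `a + gift e ≡ 12`, using that gifts are at most 4.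
    share-symmetric : ∀ e f → share e f + share f e ≡ 24
    share-symmetric e f with 12 ∸ gift e | m∸n+n≡m (≤-trans (gift≤s e) (≤-trans s≤4 (m≤m+n 4 8)))
                           | 12 ∸ gift f | m∸n+n≡m (≤-trans (gift≤s f) (≤-trans s≤4 (m≤m+n 4 8)))
    ... | a | a≡ | b | b≡ = trans (rearrange a (gift f) b (gift e)) (cong₂ _+_ a≡ b≡)
      where
      rearrange : ∀ a b c d → a + b + (c + d) ≡ a + d + (c + b)
      rearrange = solve-∀

    share-≤ : ∀ e f → share e f ≤ 12 + s
    share-≤ e f = +-mono-≤ (m∸n≤m 12 (gift e)) (gift≤s f)

    data View (v : Fin n) (e : Subset n) : Set where
      one  : Only₁ v e → weight v e ≡ 24 → View v e
      two  : ∀ {f} → Only₂ v e f → weight v e ≡ share e f → View v e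
      many : weight v e ≡ 8 → View v e

    view : ∀ {v e} → e ∈ E → v ∈ₛ e → View v e
    view {v} {e} e∈E v∈e = go (incident v) refl
      where
      go : ∀ L → incident v ≡ L → View v e
      go [] eq with () ← ∈-incident⁺ eq e∈E v∈e
      go (f ∷ []) eq with ∈-incident⁺ eq e∈E v∈e
      ... | here refl = one (incident-[e]⇒Only₁ eq) weight≡
        where
        weight≡ : weight v e ≡ 24
        weight≡ rewrite eq = refl
      go (f ∷ g ∷ []) eq with e ≟ₛ f in e≟f | ∈-incident⁺ eq e∈E v∈e
      ... | yes refl | _ = two (incident-[e,f]⇒Only₂ eq) weight≡
        where
        weight≡ : weight v e ≡ share e g
        weight≡ rewrite eq | e≟f = refl
      ... | no e≢f | here e≡f = contradiction e≡f e≢f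
      ... | no e≢f | there (here refl) = two (Only₂-sym (incident-[e,f]⇒Only₂ eq)) weight≡
        where
        weight≡ : weight v e ≡ share e f
        weight≡ rewrite eq | e≟f = refl
      go (f ∷ g ∷ h ∷ L) eq = many weight≡
        where
        weight≡ : weight v e ≡ 8
        weight≡ rewrite eq = refl

    weight-≤24 : ∀ {v e} → e ∈ E → v ∈ₛ e → weight v e ≤ 24
    weight-≤24 {e = e} e∈E v∈e with view e∈E v∈e
    ... | one  _ w≡     = ≤-reflexive w≡
    ... | two {f} _ w≡  = ≤-trans (≤-reflexive w≡) (≤-trans (share-≤ e f) (≤-trans (+-monoʳ-≤ 12 s≤4) (m≤m+n 16 8)))
    ... | many w≡       = ≤-trans (≤-reflexive w≡) (m≤m+n 8 16)

    -- Three or more edges at 8 each suffice. An isolated vertex distributes nothing, so its 24 is a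
    -- separate correction that `double-counting` collects over `isolates`.
    weight-of-vertex : ∀ v → 24 ≤ sumOf (weight v) (incident v) + (if does (isolated? v) then 24 else 0)
    weight-of-vertex v with incident v | incident-unique v
    ... | []            | _ = ≤-refl
    ... | _ ∷ []        | _ = ≤-refl
    ... | e ∷ f ∷ []    | (e≢f ∷ _) ∷ _ with e ≟ₛ e | f ≟ₛ e
    ...   | no e≢e | _        = contradiction refl e≢e
    ...   | yes _  | yes f≡e  = contradiction (sym f≡e) e≢f
    ...   | yes _  | no  _    = ≤-reflexive (trans (sym (share-symmetric e f)) (rearrange (share e f) (share f e)))
      where
      rearrange : ∀ a b → a + b ≡ a + (b + 0) + 0
      rearrange = solve-∀
    weight-of-vertex v | _ ∷ _ ∷ _ ∷ L | _ = m≤m+n 24 _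

    load : Subset n → ℕ
    load e = sumOf (λ v → weight v e) (members e)

    members↭ : ∀ e → members e ↭ filter (_∈? e) (allFin n)
    members↭ e = unique-set⇒↭ (members-unique e) (Unique-filter⁺ (_∈? e) (allFin⁺ n))
      (mk⇔ (λ v∈ → ∈-filter⁺ (_∈? e) (∈-allFin _) (∈-members⁻ v∈))
           (λ v∈ → ∈-members⁺ (proj₂ (∈-filter⁻ (_∈? e) {xs = allFin n} v∈))))

    double-counting : n * 24 ≤ sumOf load E + length isolates * 24
    double-counting = begin
      n * 24
        ≡⟨ cong (_* 24) (length-tabulate {n = n} (λ v → v)) ⟨
      length (allFin n) * 24
        ≡⟨ sumOf-const 24 (allFin n) ⟨
      sumOf (λ _ → 24) (allFin n)
        ≤⟨ sumOf-mono (allFin n) (λ {v} _ → weight-of-vertex v) ⟩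
      sumOf (λ v → sumOf (weight v) (incident v) + (if does (isolated? v) then 24 else 0)) (allFin n)
        ≡⟨ sumOf-+ _ _ (allFin n) ⟩
      sumOf (λ v → sumOf (weight v) (incident v)) (allFin n)
        + sumOf (λ v → if does (isolated? v) then 24 else 0) (allFin n)
        ≡⟨ cong₂ _+_ by-edges (sym (sumOf-filter isolated? (λ _ → 24) (allFin n))) ⟩
      sumOf load E + sumOf (λ _ → 24) isolates
        ≡⟨ cong (sumOf load E +_) (sumOf-const 24 isolates) ⟩
      sumOf load E + length isolates * 24
        ∎
      where
      open ≤-Reasoning
      -- Both sums run over incident pairs; the other pairs are padded with 0 so that the order of
      -- summation can be exchanged.
      by-edges : sumOf (λ v → sumOf (weight v) (incident v)) (allFin n) ≡ sumOf load E
      by-edges =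
        trans (cong sum (map-cong (λ v → sumOf-filter (v ∈?_) (weight v) E) (allFin n)))
        (trans (sumOf-swap _ (allFin n) E)
        (cong sum (map-cong (λ e → sym (trans (sumOf-↭ _ (members↭ e))
                                   (sumOf-filter (_∈? e) (λ v → weight v e) (allFin n)))) E)))

    -- Links to pendant edges (hot vertices) and the causes of a large load.

    Hot : Subset n → Fin n → Set
    Hot e v = ∃[ f ] (Only₂ v e f × Pendant f)

    hot⇒same-edge : ∀ {u v e f g} → u ≢ v → Only₂ u e f → Pendant f → Only₂ v e g → Pendant g → f ≡ g
    hot⇒same-edge u≢v u₂ pf v₂ pg =
      let p , p₁ = Pendant⇒Only₁ (Only₂.f∈E u₂) pf
          q , q₁ = Pendant⇒Only₁ (Only₂.f∈E v₂) pg
      in pendant-path-unique u≢v u₂ v₂ p₁ q₁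

    -- Used with `R` saying that the only edge is `e`, or that the only edges are `e` and `f`; in
    -- both cases `u` and `v` are twins.
    record TwinPair (e : Subset n) (R : Fin n → Set) : Set where
      constructor twinPair
      field
        {u v} : Fin n
        u≢v   : u ≢ v
        Ru    : R u
        Rv    : R v

    -- The two exceptions to the load bound `t`. With degree-1 twins a load can be as large as 96,
    -- hence no bound is recorded there.
    data Excess (e : Subset n) : Set where
      pendantTwins : TwinPair e (λ v → Only₁ v e) → Excess e
      linkTwins    : ∀ {f} → TwinPair e (λ v → Only₂ v e f) → load e ≤ 60 → Excess e

    gift-cases : ∀ e → (Pendant e × gift e ≡ s) ⊎ (¬ Pendant e × gift e ≡ 0)
    gift-cases e with pendant? e
    ... | yes pe = inj₁ (pe , refl)
    ... | no ¬pe = inj₂ (¬pe , refl)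

    base : Subset n → ℕ
    base e = 12 ∸ gift e

    classify : ∀ {v e} → e ∈ E → v ∈ₛ e → Only₁ v e ⊎ ((Hot e v × weight v e ≤ base e + s) ⊎ weight v e ≤ base e)
    classify {v} {e} e∈E v∈e with view e∈E v∈e
    ... | one v₁ _  = inj₁ v₁
    -- `8 ≤ 12 ∸ gift e`, because gifts are at most 4.
    ... | many w≡   = inj₂ (inj₂ (≤-trans (≤-reflexive w≡) (∸-monoʳ-≤ 12 (≤-trans (gift≤s e) s≤4))))
    ... | two {f} v₂ w≡ with gift-cases f
    ...   | inj₁ (pf , f≡s) = inj₂ (inj₁ ((f , v₂ , pf) , ≤-reflexive (trans w≡ (cong (base e +_) f≡s))))
    ...   | inj₂ (_  , f≡0) = inj₂ (inj₂ (≤-reflexive (trans w≡ (trans (cong (base e +_) f≡0) (+-identityʳ _)))))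

    load-↭ : ∀ {e xs} → members e ↭ xs → load e ≡ sumOf (λ v → weight v e) xs
    load-↭ {e} = sumOf-↭ (λ v → weight v e)

    hot-pair⇒linkTwins : ∀ {e u v} → u ≢ v → Hot e u → Hot e v →
                         ∃[ f ] (TwinPair e (λ v → Only₂ v e f) × Pendant f)
    hot-pair⇒linkTwins {e} u≢v (f , u₂ , pf) (g , v₂ , pg) =
      f , twinPair u≢v u₂ (subst (Only₂ _ e) (sym (hot⇒same-edge u≢v u₂ pf v₂ pg)) v₂) , pf

    -- Edges have equal size, so distinct ones are incomparable. Supplies a vertex of `e` that
    -- cannot link it to `f`.
    member-outside : ∀ {e f} → e ∈ E → f ∈ E → e ≢ f → ∃[ w ] (w ∈ members e × w ∉ₛ f)
    member-outside {e} {f} e∈E f∈E e≢f with some-or-all (members e) (λ {w} _ → outside? w)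
      where
      outside? : ∀ w → w ∉ₛ f ⊎ w ∈ₛ f
      outside? w with w ∈? f
      ... | yes w∈f = inj₂ w∈f
      ... | no  w∉f = inj₁ w∉f
    ... | inj₁ w   = w
    ... | inj₂ e⊆f = contradiction (⊆∧∣≡∣⇒≡ (e⊆f ∘ ∈-members⁺) (trans (∣e∣≡4 e∈E) (sym (∣e∣≡4 f∈E)))) e≢f

    -- c bounds the total excess over t: of one load 96, of two loads 72 and 60, or of four loads 60.
    module Bounded (t c : ℕ) (48+s≤t : 48 + s ≤ t)
                   (cold-bound : 24 + 3 * (12 ∸ s) ≤ t)
                   (hot-bound : ∀ {v p q e f} → Only₂ v e f → Only₁ p e → Only₁ q f → 24 + (3 * (12 ∸ s) + s) ≤ t)
                   (96≤t+c : 96 ≤ t + c) (72+60-bound : 72 ∸ t + (60 ∸ t) ≤ c) (4*60-bound : 4 * (60 ∸ t) ≤ c) where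

      -- One degree-1 vertex brings at most 24; without a second one, the other three vertices bring
      -- at most `12 ∸ s` each, plus `s` at a link. Two links are twins, and even three links bring
      -- at most 12 each: 24 + 36 = 60.
      analyse-pendant : ∀ {e} → e ∈ E → Pendant e → load e ≤ t ⊎ Excess e
      analyse-pendant {e} e∈E pe
        with p , p₁ ← Pendant⇒Only₁ e∈E pe
        with ys , e↭ ← extract (∈-members⁺ (Only₁.v∈e p₁))
        with p≢ ∷ ys! ← Unique-resp-↭ e↭ (members-unique e)
        with ∣ys∣≡3 ← suc-injective (trans (sym (↭-length e↭)) (∣members∣≡4 e∈E))
        with some-or-all ys (λ y∈ → classify e∈E (∈-members⁻ (∈-resp-↭ (↭-sym e↭) (there y∈))))
      ... | inj₁ (y , y∈ , y₁) = inj₂ (pendantTwins (twinPair (All.lookup p≢ y∈) p₁ y₁))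
      ... | inj₂ classes with some-or-all ys classes
      ...   | inj₂ cold = inj₁ (begin
              load e                                    ≡⟨ load-↭ {e} e↭ ⟩
              weight p e + sumOf (λ v → weight v e) ys  ≤⟨ +-mono-≤ (weight-≤24 e∈E (Only₁.v∈e p₁)) (sumOf-≤ ys cold) ⟩
              24 + length ys * base e                   ≡⟨ cong₂ (λ l g → 24 + l * (12 ∸ g)) ∣ys∣≡3 (gift-pendant e pe) ⟩
              24 + 3 * (12 ∸ s)                         ≤⟨ cold-bound ⟩
              t                                         ∎)
              where open ≤-Reasoning
      ...   | inj₁ (_ , _ , (_ , x₂ , pf) , _) with sumOf-one-hot ys! classes
      ...     | inj₂ sum≤ = inj₁ (begin
                load e                                    ≡⟨ load-↭ {e} e↭ ⟩
                weight p e + sumOf (λ v → weight v e) ys  ≤⟨ +-mono-≤ (weight-≤24 e∈E (Only₁.v∈e p₁)) sum≤ ⟩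
                24 + (length ys * base e + s)             ≡⟨ cong₂ (λ l g → 24 + (l * (12 ∸ g) + s)) ∣ys∣≡3 (gift-pendant e pe) ⟩
                -- The hot vertex lies in two pendant edges, `e` and the one it links to, as
                -- `hot-bound` requires.
                24 + (3 * (12 ∸ s) + s)                   ≤⟨ hot-bound x₂ p₁ (proj₂ (Pendant⇒Only₁ (Only₂.f∈E x₂) pf)) ⟩
                t                                         ∎)
                where open ≤-Reasoning
      ...     | inj₁ (y , z , y≢z , _ , _ , hy , hz)
              with f , twins , _ ← hot-pair⇒linkTwins y≢z hy hz = inj₂ (linkTwins twins (begin
                load e                                    ≡⟨ load-↭ {e} e↭ ⟩
                weight p e + sumOf (λ v → weight v e) ys  ≤⟨ +-mono-≤ (weight-≤24 e∈E (Only₁.v∈e p₁)) (sumOf-≤ ys warm) ⟩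
                24 + length ys * 12                       ≡⟨ cong (λ l → 24 + l * 12) {length ys} {3} ∣ys∣≡3 ⟩
                60                                        ∎))
                where
                open ≤-Reasoning
                base+s≡12 : base e + s ≡ 12
                base+s≡12 = trans (cong (λ g → 12 ∸ g + s) (gift-pendant e pe)) (m∸n+n≡m (≤-trans s≤4 (m≤m+n 4 8)))
                warm : ∀ {y} → y ∈ ys → weight y e ≤ 12
                warm y∈ with classes y∈
                ... | inj₁ (_ , w≤) = ≤-trans w≤ (≤-reflexive base+s≡12)
                ... | inj₂ w≤       = ≤-trans w≤ (m∸n≤m 12 (gift e))

      analyse-¬pendant : ∀ {e} → e ∈ E → ¬ Pendant e → load e ≤ t ⊎ Excess e
      analyse-¬pendant {e} e∈E ¬pe with some-or-all (members e) (λ v∈ → classify e∈E (∈-members⁻ v∈))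
      ... | inj₁ (_ , _ , p₁) = contradiction (Only₁⇒Pendant p₁) ¬pe
      ... | inj₂ classes with sumOf-one-hot (members-unique e) classes
      ...   | inj₂ sum≤ = inj₁ (begin
              load e                            ≤⟨ sum≤ ⟩
              length (members e) * base e + s   ≡⟨ cong₂ (λ l g → l * (12 ∸ g) + s) (∣members∣≡4 e∈E) (gift-¬pendant e ¬pe) ⟩
              48 + s                            ≤⟨ 48+s≤t ⟩
              t                                 ∎)
              where open ≤-Reasoning
      ...   | inj₁ (y , z , y≢z , _ , _ , hy , hz)
            with f , twins , pf ← hot-pair⇒linkTwins y≢z hy hz
            -- All links of `e` lead to `f`, so `w`, which is outside `f`, is not one and brings at
            -- most 12. The other three bring at most 16 each: 12 + 48 = 60.
            with w , w∈ , w∉f ← member-outside e∈E (Only₂.f∈E (TwinPair.Ru twins)) (Only₂.e≢f (TwinPair.Ru twins))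
            with zs , e↭ ← extract w∈
            with ∣zs∣≡3 ← suc-injective (trans (sym (↭-length e↭)) (∣members∣≡4 e∈E)) = inj₂ (linkTwins twins (begin
              load e                                    ≡⟨ load-↭ {e} e↭ ⟩
              weight w e + sumOf (λ v → weight v e) zs  ≤⟨ +-mono-≤ cold (sumOf-≤ zs warm) ⟩
              12 + length zs * 16                       ≡⟨ cong (λ l → 12 + l * 16) {length zs} {3} ∣zs∣≡3 ⟩
              60                                        ∎))
              where
              open ≤-Reasoning
              warm : ∀ {v} → v ∈ zs → weight v e ≤ 16
              warm v∈ with classes (∈-resp-↭ (↭-sym e↭) (there v∈))
              ... | inj₁ (_ , w≤) = ≤-trans w≤ (+-mono-≤ (m∸n≤m 12 (gift e)) s≤4)
              ... | inj₂ w≤       = ≤-trans w≤ (≤-trans (m∸n≤m 12 (gift e)) (m≤m+n 12 4))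
              u = TwinPair.u twins
              u₂ = TwinPair.Ru twins
              cold : weight w e ≤ 12
              cold with classes w∈
              ... | inj₂ w≤ = ≤-trans w≤ (m∸n≤m 12 (gift e))
              ... | inj₁ ((g , w₂ , pg) , _) = contradiction
                (subst (w ∈ₛ_) (sym (hot⇒same-edge {u} {w} (λ u≡w → w∉f (subst (_∈ₛ f) u≡w (Only₂.v∈f u₂))) u₂ pf w₂ pg)) (Only₂.v∈f w₂))
                w∉f

      analyse : ∀ {e} → e ∈ E → load e ≤ t ⊎ Excess e
      analyse {e} e∈E with pendant? e
      ... | yes pe = analyse-pendant e∈E pe
      ... | no ¬pe = analyse-¬pendant e∈E ¬pe

      -- Total excess when some edge has twins of degree 1.

      module _ {e u v} (u≢v : u ≢ v) (u₁ : Only₁ u e) (v₁ : Only₁ v e) where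

        private
          e∈E = Only₁.e∈E u₁

        -- The twins `u`, `v` and those of `f` lie in a common edge, which must be `e`, the only
        -- edge at `u`. Degree-1 twins of `f` cannot lie in `e`, and link twins of `f` then have `e`
        -- as their second edge.
        pendantTwins⇒other-excess : ∀ {f} → f ≢ e → Excess f → TwinPair f (λ w → Only₂ w f e) × load f ≤ 60
        pendantTwins⇒other-excess {f} f≢e (pendantTwins (twinPair a≢b a₁ b₁))
          with g , g∈E , u∈g , a∈g , _ ← twin-pairs⇒edge
                 ((u≢v ∷ Only₁-≢ f≢e u₁ a₁ ∷ Only₁-≢ f≢e u₁ b₁ ∷ [])
                   ∷ (Only₁-≢ f≢e v₁ a₁ ∷ Only₁-≢ f≢e v₁ b₁ ∷ []) ∷ (a≢b ∷ []) ∷ [] ∷ [])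
                 (Only₁⇒Twins u₁ v₁) (Only₁⇒Twins a₁ b₁)
          = contradiction (trans (sym (Only₁.only a₁ g∈E a∈g)) (Only₁.only u₁ g∈E u∈g)) f≢e
        pendantTwins⇒other-excess {f} f≢e (linkTwins twins@(twinPair a≢b a₂ b₂) load≤60)
          with g , g∈E , u∈g , a∈g , _ ← twin-pairs⇒edge
                 ((u≢v ∷ Only₁-Only₂-≢ u₁ a₂ ∷ Only₁-Only₂-≢ u₁ b₂ ∷ [])
                   ∷ (Only₁-Only₂-≢ v₁ a₂ ∷ Only₁-Only₂-≢ v₁ b₂ ∷ []) ∷ (a≢b ∷ []) ∷ [] ∷ [])
                 (Only₁⇒Twins u₁ v₁) (Only₂⇒Twins a₂ b₂)
          with refl ← Only₁.only u₁ g∈E u∈g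
          with Only₂.only a₂ g∈E a∈g
        ... | inj₁ e≡f  = contradiction (sym e≡f) f≢e
        ... | inj₂ refl = twins , load≤60

        -- Now `e` consists of `u`, `v`, `a`, `b`. Any further exceptional `g` has links into `e`,
        -- which have degree 2 and so are `a` or `b`; hence `g` is `f`. The two loads are at most 24
        -- + 24 + 12 + 12 = 72 and 60.
        pendantTwins-and-link : ∀ {f} → TwinPair f (λ w → Only₂ w f e) → load f ≤ 60 → sumOf load E ≤ length E * t + c
        pendantTwins-and-link {f} (twinPair {a} {b} a≢b a₂ b₂) load-f = ≤-trans
          (sumOf-except {h = λ g → load g ∸ t} (e ∷ f ∷ []) (distinct G)
            (λ g∈E → Sum.map₂ (λ g∈L → g∈L , m≤n+m∸n _ t) (exceptions g∈E)))
          (+-monoʳ-≤ (length E * t) (≤-trans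
            (+-mono-≤ (∸-monoˡ-≤ t load-e) (≤-trans (≤-reflexive (+-identityʳ _)) (∸-monoˡ-≤ t load-f)))
            72+60-bound))
          where
          e↭ : members e ↭ u ∷ v ∷ a ∷ b ∷ []
          e↭ = four-members e∈E
            ((u≢v ∷ Only₁-Only₂-≢ u₁ a₂ ∷ Only₁-Only₂-≢ u₁ b₂ ∷ [])
              ∷ (Only₁-Only₂-≢ v₁ a₂ ∷ Only₁-Only₂-≢ v₁ b₂ ∷ []) ∷ (a≢b ∷ []) ∷ [] ∷ [])
            (Only₁.v∈e u₁ ∷ Only₁.v∈e v₁ ∷ Only₂.v∈f a₂ ∷ Only₂.v∈f b₂ ∷ [])
          -- `e` is pendant and gives up `s` at `w`, so even with a gift from the other edge it gets
          -- at most 12.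
          link-weight : ∀ {w} → Only₂ w f e → weight w e ≤ 12
          link-weight {w} w₂ with view e∈E (Only₂.v∈f w₂)
          ... | one  w₁ _    = contradiction refl (Only₁-Only₂-≢ w₁ w₂)
          ... | many w≡      = ≤-trans (≤-reflexive w≡) (m≤m+n 8 4)
          ... | two {g} _ w≡ = ≤-trans (≤-reflexive w≡) (≤-trans
            (+-mono-≤ (≤-reflexive (cong (12 ∸_) (gift-pendant e (Only₁⇒Pendant u₁)))) (gift≤s g))
            (≤-reflexive (m∸n+n≡m (≤-trans s≤4 (m≤m+n 4 8)))))
          load-e : load e ≤ 72
          load-e = ≤-trans (≤-reflexive (load-↭ {e} e↭))
            (+-mono-≤ (weight-≤24 e∈E (Only₁.v∈e u₁)) (+-mono-≤ (weight-≤24 e∈E (Only₁.v∈e v₁))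
              (+-mono-≤ (link-weight a₂) (+-mono-≤ (link-weight b₂) z≤n))))
          same-link : ∀ {g w x} → g ≢ e → g ∈ E → Only₂ w f e → Only₂ x g e → x ≡ w → g ≡ f
          same-link g≢e g∈E w₂ x₂ x≡w = Sum.[ (λ g≡f → g≡f) , (λ g≡e → contradiction g≡e g≢e) ]
            (Only₂.only w₂ g∈E (subst (_∈ₛ _) x≡w (Only₂.v∈e x₂)))
          linked : ∀ {g x} → g ≢ e → g ∈ E → Only₂ x g e → x ∈ u ∷ v ∷ a ∷ b ∷ [] → g ≡ f
          linked g≢e g∈E x₂ (here x≡u)                         = contradiction (sym x≡u) (Only₁-Only₂-≢ u₁ x₂)
          linked g≢e g∈E x₂ (there (here x≡v))                 = contradiction (sym x≡v) (Only₁-Only₂-≢ v₁ x₂)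
          linked g≢e g∈E x₂ (there (there (here x≡a)))         = same-link g≢e g∈E a₂ x₂ x≡a
          linked g≢e g∈E x₂ (there (there (there (here x≡b)))) = same-link g≢e g∈E b₂ x₂ x≡b
          exceptions : ∀ {g} → g ∈ E → load g ≤ t ⊎ g ∈ e ∷ f ∷ []
          exceptions {g} g∈E = Sum.map₂ exceptional (analyse g∈E)
            where
            exceptional : Excess g → g ∈ e ∷ f ∷ []
            exceptional excess with g ≟ₛ e
            ... | yes g≡e = here g≡e
            ... | no  g≢e =
              let x₂ = TwinPair.Ru (proj₁ (pendantTwins⇒other-excess g≢e excess))
              in there (here (linked g≢e g∈E x₂ (∈-resp-↭ e↭ (∈-members⁺ (Only₂.v∈f x₂)))))

        total-pendantTwins : sumOf load E ≤ length E * t + c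
        total-pendantTwins with some-or-all E split
          where
          split : ∀ {f} → f ∈ E → (TwinPair f (λ w → Only₂ w f e) × load f ≤ 60) ⊎ (load f ≤ t ⊎ f ≡ e)
          split {f} f∈E with f ≟ₛ e | analyse f∈E
          ... | yes f≡e | _            = inj₂ (inj₂ f≡e)
          ... | no  _   | inj₁ light   = inj₂ (inj₁ light)
          ... | no  f≢e | inj₂ excess  = inj₁ (pendantTwins⇒other-excess f≢e excess)
        ... | inj₁ (_ , _ , twins , load-f) = pendantTwins-and-link twins load-f
        ... | inj₂ rest = ≤-trans
          (sumOf-except (e ∷ []) (distinct G) λ f∈E → Sum.map₂ (λ { refl → here refl , load-e }) (rest f∈E))
          (≤-reflexive (cong (length E * t +_) (+-identityʳ c)))
          where
          load-e : load e ≤ t + c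
          load-e = ≤-trans (sumOf-≤ (members e) (λ w∈ → weight-≤24 e∈E (∈-members⁻ w∈)))
                           (≤-trans (≤-reflexive (cong (_* 24) (∣members∣≡4 e∈E))) 96≤t+c)

      -- Total excess when all exceptional edges have link twins.

      LinkExcess : Subset n → Set
      LinkExcess e = ∃[ f ] (TwinPair e (λ v → Only₂ v e f) × load e ≤ 60)

      -- Let `a`, `b` be link twins of an exceptional `g`, with second edge `h`. If they meet `u`,
      -- `v`, then `g` is `e` or `f`. Otherwise the two pairs form `e` or `f`; that edge is `g` or
      -- `h`, and its vertex `x` or `x′` is one of `a`, `b`, so `g` is that edge or the other edge
      -- at this vertex. This leaves four candidates, with loads of at most 60.
      total-linkTwins : ∀ {u v e f} → u ≢ v → Only₂ u e f → Only₂ v e f →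
                        (∀ {g} → g ∈ E → load g ≤ t ⊎ LinkExcess g) → sumOf load E ≤ length E * t + c
      total-linkTwins {u} {v} {e} {f} u≢v u₂ v₂ all-link
        with x , y , e↭ ← two-more-members (Only₂.e∈E u₂) u≢v (Only₂.v∈e u₂) (Only₂.v∈e v₂)
        with x′ , y′ , f↭ ← two-more-members (Only₂.f∈E u₂) u≢v (Only₂.v∈f u₂) (Only₂.v∈f v₂)
        = ≤-trans
          (sumOf-except {h = λ _ → 60 ∸ t} L (distinct G) λ g∈E → Sum.map₂ (exception g∈E) (all-link g∈E))
          (+-monoʳ-≤ (length E * t) (≤-trans (≤-reflexive (sumOf-const (60 ∸ t) L)) 4*60-bound))
        where
        L : List (Subset n)
        L = e ∷ f ∷ other x e ∷ other x′ f ∷ []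

        -- The twins u, v and a, b form the edge d ∈ {e, f}, so a and b are its two further vertices x, y.
        through : ∀ {d x y a b g h} → members d ↭ u ∷ v ∷ x ∷ y ∷ [] → d ∈ E → d ∈ L → other x d ∈ L →
                  a ≢ b → u ≢ a → v ≢ a → u ≢ b → v ≢ b →
                  Only₂ a g h → Only₂ b g h → a ∈ₛ d → b ∈ₛ d → g ∈ L
        through {d} {x} {y} {a} {b} {g} {h} d↭ d∈E d∈L o∈L a≢b u≢a v≢a u≢b v≢b a₂ b₂ a∈d b∈d =
          finish (Only₂.only x₂ d∈E x∈d)
          where
          ∈-rest : ∀ {z} → z ∈ₛ d → u ≢ z → v ≢ z → z ∈ x ∷ y ∷ []
          ∈-rest z∈d u≢z v≢z = Any.tail (v≢z ∘ sym) (Any.tail (u≢z ∘ sym) (∈-resp-↭ d↭ (∈-members⁺ z∈d)))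
          x-is : x ≡ a ⊎ x ≡ b
          x-is with ∈-rest a∈d u≢a v≢a | ∈-rest b∈d u≢b v≢b
          ... | here a≡x         | _                = inj₁ (sym a≡x)
          ... | there (here _)   | here b≡x         = inj₂ (sym b≡x)
          ... | there (here a≡y) | there (here b≡y) = contradiction (trans a≡y (sym b≡y)) a≢b
          x₂ : Only₂ x g h
          x₂ = Sum.[ (λ { refl → a₂ }) , (λ { refl → b₂ }) ] x-is
          x∈d : x ∈ₛ d
          x∈d = Sum.[ (λ { refl → a∈d }) , (λ { refl → b∈d }) ] x-is
          finish : d ≡ g ⊎ d ≡ h → g ∈ L
          finish (inj₁ refl) = d∈L
          finish (inj₂ refl) = subst (_∈ L) (other-Only₂ (Only₂-sym x₂)) o∈L

        exception : ∀ {g} → g ∈ E → LinkExcess g → g ∈ L × load g ≤ t + (60 ∸ t)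
        exception {g} g∈E (h , twinPair {a} {b} a≢b a₂ b₂ , load-g) = g∈L , ≤-trans load-g (m≤n+m∸n 60 t)
          where
          in-e-or-f : ∀ {w z} → Only₂ w e f → Only₂ z g h → w ≡ z → g ∈ L
          in-e-or-f w₂ z₂ refl with Only₂.only w₂ g∈E (Only₂.v∈e z₂)
          ... | inj₁ g≡e = here g≡e
          ... | inj₂ g≡f = there (here g≡f)
          g∈L : g ∈ L
          g∈L with u Fin.≟ a | v Fin.≟ a | u Fin.≟ b | v Fin.≟ b
          ... | yes u≡a | _ | _ | _ = in-e-or-f u₂ a₂ u≡a
          ... | no _ | yes v≡a | _ | _ = in-e-or-f v₂ a₂ v≡a
          ... | no _ | no _ | yes u≡b | _ = in-e-or-f u₂ b₂ u≡b
          ... | no _ | no _ | no _ | yes v≡b = in-e-or-f v₂ b₂ v≡b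
          ... | no u≢a | no v≢a | no u≢b | no v≢b
            with d , d∈E , u∈d , a∈d , b∈d ← twin-pairs⇒edge
                   ((u≢v ∷ u≢a ∷ u≢b ∷ []) ∷ (v≢a ∷ v≢b ∷ []) ∷ (a≢b ∷ []) ∷ [] ∷ [])
                   (Only₂⇒Twins u₂ v₂) (Only₂⇒Twins a₂ b₂)
            with Only₂.only u₂ d∈E u∈d
          ...   | inj₁ refl = through e↭ d∈E (here refl) (there (there (here refl)))
                                      a≢b u≢a v≢a u≢b v≢b a₂ b₂ a∈d b∈d
          ...   | inj₂ refl = through f↭ d∈E (there (here refl)) (there (there (there (here refl))))
                                      a≢b u≢a v≢a u≢b v≢b a₂ b₂ a∈d b∈d

      total : sumOf load E ≤ length E * t + c
      total with some-or-all E split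
        where
        split : ∀ {e} → e ∈ E → TwinPair e (λ v → Only₁ v e) ⊎ (load e ≤ t ⊎ LinkExcess e)
        split e∈E with analyse e∈E
        ... | inj₁ light                = inj₂ (inj₁ light)
        ... | inj₂ (pendantTwins twins) = inj₁ twins
        ... | inj₂ (linkTwins twins l)  = inj₂ (inj₂ (_ , twins , l))
      ... | inj₁ (_ , _ , twinPair u≢v u₁ v₁) = total-pendantTwins u≢v u₁ v₁
      ... | inj₂ all-link with some-or-all E (Sum.swap ∘ all-link)
      ...   | inj₂ light = ≤-trans (sumOf-≤ E light) (m≤m+n _ c)
      ...   | inj₁ (_ , _ , _ , twinPair u≢v u₂ v₂ , _) = total-linkTwins u≢v u₂ v₂ all-link

      -- Both kinds of excess come with twins in an edge, so nothing exceeds `t`; this pays for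
      -- having two or three isolated vertices.
      total-twin-free : (∀ {u v e} → u ≢ v → e ∈ E → u ∈ₛ e → ¬ Twins u v) → sumOf load E ≤ length E * t
      total-twin-free twin-free = sumOf-≤ E light
        where
        light : ∀ {e} → e ∈ E → load e ≤ t
        light e∈E with analyse e∈E
        ... | inj₁ l = l
        ... | inj₂ (pendantTwins (twinPair u≢v u₁ v₁)) =
          ⊥-elim (twin-free u≢v e∈E (Only₁.v∈e u₁) (Only₁⇒Twins u₁ v₁))
        ... | inj₂ (linkTwins (twinPair u≢v u₂ v₂) _) =
          ⊥-elim (twin-free u≢v e∈E (Only₂.v∈e u₂) (Only₂⇒Twins u₂ v₂))

  -- Parameters with and without isolated vertices.

  no-isolates : isolates ≡ [] → n * 24 ≤ size G * 52 + 44
  no-isolates eq = begin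
    n * 24                              ≤⟨ W.double-counting ⟩
    sumOf W.load E + length isolates * 24 ≡⟨ cong (λ L → sumOf W.load E + length L * 24) eq ⟩
    sumOf W.load E + 0                  ≡⟨ +-identityʳ _ ⟩
    sumOf W.load E                      ≤⟨ B.total ⟩
    size G * 52 + 44                    ∎
    where
    open ≤-Reasoning
    module W = Weights 4 ≤-refl
    -- A pendant edge with one link has load at most 24 + 3 · 8 + 4 = 52, a non-pendant one at most
    -- 48 + 4 = 52. The total excess is at most 96 - 52 = 44, or (72 - 52) + (60 - 52) = 28, or 4 ·
    -- 8 = 32.
    module B = W.Bounded 52 44 ≤-refl (from-yes (48 ≤? 52)) (λ _ _ _ → ≤-refl)
                         ≤-refl (from-yes (28 ≤? 44)) (from-yes (32 ≤? 44))

  some-isolates : ∀ {z} → Isolated z → n * 24 ≤ size G * 51 + 72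
  some-isolates {z} iz = begin
    n * 24                              ≤⟨ W.double-counting ⟩
    sumOf W.load E + length isolates * 24 ≤⟨ bound isolates isolates-unique isolates-isolated ⟩
    size G * 51 + 72                    ∎
    where
    open ≤-Reasoning
    module W = Weights 3 (from-yes (3 ≤? 4))
    -- Now 48 + 3 = 24 + 3 · 9 = 51. A link in a pendant edge would allow 54, but an isolated vertex
    -- excludes it. The excess is at most 96 - 51 = 45.
    module B = W.Bounded 51 45 ≤-refl ≤-refl
                         (λ v₂ p₁ q₁ → contradiction q₁ (isolated⇒no-adjacent-pendants iz v₂ p₁))
                         ≤-refl (from-yes (30 ≤? 45)) (from-yes (36 ≤? 45))
    bound : ∀ I → Unique I → All Isolated I → sumOf W.load E + length I * 24 ≤ size G * 51 + 72
    bound [] _ _ = ≤-trans (+-monoˡ-≤ 0 B.total)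
      (≤-trans (≤-reflexive (+-assoc (size G * 51) 45 0)) (+-monoʳ-≤ (size G * 51) (from-yes (45 ≤? 72))))
    bound (_ ∷ []) _ _ = ≤-trans (+-monoˡ-≤ 24 B.total)
      (≤-trans (≤-reflexive (+-assoc (size G * 51) 45 24)) (+-monoʳ-≤ (size G * 51) (from-yes (69 ≤? 72))))
    -- Two isolated vertices exclude twins and thus all excess, so 72 = 3 · 24 covers up to three of
    -- them; a single one costs 45 + 24 = 69.
    bound I@(x ∷ y ∷ L) I!@((x≢y ∷ _) ∷ _) is@(ix ∷ iy ∷ _) =
      +-mono-≤ (B.total-twin-free (two-isolated⇒¬twins x≢y ix iy)) (*-monoˡ-≤ 24 {length I} {3} (at-most-3 L I! is))
      where
      at-most-3 : ∀ L → Unique (x ∷ y ∷ L) → All Isolated (x ∷ y ∷ L) → length (x ∷ y ∷ L) ≤ 3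
      at-most-3 [] _ _ = from-yes (2 ≤? 3)
      at-most-3 (_ ∷ []) _ _ = ≤-refl
      at-most-3 (_ ∷ _ ∷ _) ((a ∷ b ∷ c ∷ _) ∷ (d ∷ e ∷ _) ∷ (f ∷ _) ∷ _) (i ∷ j ∷ k ∷ l ∷ _) =
        contradiction (i ∷ j ∷ k ∷ l ∷ []) (¬four-isolated ((a ∷ b ∷ c ∷ []) ∷ (d ∷ e ∷ []) ∷ (f ∷ []) ∷ [] ∷ []))

  lower-bound : 100 ≤ n → 6 * n ≤ 13 * size G + 11
  lower-bound 100≤n = *-cancelʳ-≤ (6 * n) (13 * size G + 11) 4 (begin
    6 * n * 4                ≡⟨ lhs n ⟩
    n * 24                   ≤⟨ by-isolates isolates refl ⟩
    size G * 52 + 44         ≡⟨ rhs (size G) ⟩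
    (13 * size G + 11) * 4   ∎)
    where
    open ≤-Reasoning
    lhs : ∀ n → 6 * n * 4 ≡ n * 24
    lhs = solve-∀
    rhs : ∀ m → m * 52 + 44 ≡ (13 * m + 11) * 4
    rhs = solve-∀
    -- The gain of 1 per edge covers 72 - 44 = 28 once there are 28 edges.
    absorb : ∀ m → m * 51 + (28 + 44) ≤ m * 52 + 44 ⊎ m ≤ 27
    absorb m with 28 ≤? m
    ... | no  28≰m = inj₂ (≤-pred (≰⇒> 28≰m))
    ... | yes 28≤m = inj₁ (≤-trans (+-monoʳ-≤ (m * 51) (+-monoˡ-≤ 44 28≤m)) (≤-reflexive (collect m)))
      where
      collect : ∀ m → m * 51 + (m + 44) ≡ m * 52 + 44
      collect = solve-∀
    by-isolates : ∀ I → isolates ≡ I → n * 24 ≤ size G * 52 + 44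
    by-isolates []      eq = no-isolates eq
    by-isolates (z ∷ _) eq with subst (All Isolated) eq isolates-isolated
    ... | iz ∷ _ with absorb (size G)
    ...   | inj₁ enough = ≤-trans (some-isolates iz) enough
    -- With at most 27 edges, 24 · 100 = 2400 would be at most 27 · 51 + 72 = 1449.
    ...   | inj₂ m≤27   = contradiction
      (≤-trans (*-monoˡ-≤ 24 100≤n) (≤-trans (some-isolates iz) (+-monoˡ-≤ 72 (*-monoˡ-≤ 51 {size G} {27} m≤27))))
      (from-no (2400 ≤? 1449))

-- Extremal hypergraphs

_∈ᵇ_ : ℕ → List ℕ → Bool
v ∈ᵇ xs = any (_≡ᵇ v) xs

Unique-++-disjoint : {A : Set} {xs ys : List A} → Unique (xs ++ ys) → ∀ {x} → x ∈ xs → x ∉ ys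
Unique-++-disjoint {xs = _ ∷ xs} (x∉ ∷ _) (here refl) x∈ys = All.lookup x∉ (∈-++⁺ʳ xs x∈ys) refl
Unique-++-disjoint {xs = _ ∷ xs} (_ ∷ u)  (there x∈)  x∈ys = Unique-++-disjoint u x∈ x∈ys

∈ᵇ⇒∈ : ∀ {v} xs → T (v ∈ᵇ xs) → v ∈ xs
∈ᵇ⇒∈ xs t = Any.map (λ {x} x≡ᵇv → sym (≡ᵇ⇒≡ x _ x≡ᵇv)) (any⁻ _ xs t)

hits : List ℕ → List ℕ → ℕ
hits A = count (_∈ᵇ A)

-- Exhaustive search for small closed sets.

module Search (N : ℕ) (E : List (List ℕ)) where

  -- If search r S holds, then every closed set of at most length S + r = 4 vertices containing S has
  -- 3 elements: a closed set meeting A ∈ E contains a second vertex of A.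
  search : ℕ → List ℕ → Bool
  branch : ℕ → List ℕ → List ℕ → Bool
  search r S = any (λ A → (hits A S ≡ᵇ 1) ∧ branch r S A) E ∨ ((length S ≡ᵇ 3) ∧ branch r S (upTo N))
  branch zero    S ws = true
  branch (suc r) S ws = all (λ w → (w ∈ᵇ S) ∨ search r (w ∷ S)) ws

  searchAll : Bool
  searchAll = all (λ v → search 3 (v ∷ [])) (upTo N)

  module _ {M : List ℕ} (M! : Unique M) (M<N : ∀ {v} → v ∈ M → v < N) (∣M∣≤4 : length M ≤ 4)
           (closed : ∀ {A} → A ∈ E → hits A M ≢ 1) where

    -- `M` is a closed set, `S` the part of it found so far and `R` the rest. The search does not
    -- know `R`; it tries all candidates, and the proof follows a branch that picks from `R`.
    search-sound : ∀ r S {R} → length S + r ≡ 4 → M ↭ S ++ R → T (search r S) → length M ≡ 3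
    branch-sound : ∀ r S {R} → length S + r ≡ 4 → M ↭ S ++ R → ∀ {w ws} → w ∈ R → w ∈ ws →
                   T (branch r S ws) → length M ≡ 3

    search-sound r S {R} eq M↭ t with Equivalence.to T-∨ t
    ... | inj₁ t₁
      with A , A∈ , t₂ ← find (any⁻ _ E t₁)
      with hit , t₃ ← Equivalence.to T-∧ t₂
      with w , w∈R , w∈ᵇA ← count>0⇒∃ (_∈ᵇ A) R (λ R-misses → closed A∈
             (trans (sumOf-↭ _ M↭) (trans (sumOf-++ _ S R) (cong₂ _+_ (≡ᵇ⇒≡ _ 1 hit) R-misses))))
      = branch-sound r S eq M↭ w∈R (∈ᵇ⇒∈ A (Equivalence.from T-≡ w∈ᵇA)) t₃
    -- Nothing is left to find, so `M` is `S`, which the guard requires to have 3 elements.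
    search-sound r S {[]} eq M↭ t | inj₂ t₁ =
      trans (↭-length M↭) (trans (cong length (++-identityʳ S)) (≡ᵇ⇒≡ _ 3 (proj₁ (Equivalence.to T-∧ t₁))))
    search-sound r S {w ∷ R} eq M↭ t | inj₂ t₁ =
      branch-sound r S eq M↭ (here refl) (∈-upTo⁺ (M<N (∈-resp-↭ (↭-sym M↭) (∈-++⁺ʳ S (here refl)))))
        (proj₂ (Equivalence.to T-∧ t₁))

    -- `S` has four elements already, and one from `R` would be a fifth.
    branch-sound zero    S {_ ∷ R} eq M↭ _ _ _ = contradiction ∣M∣≤4 (<⇒≱ (begin
      5                     ≡⟨ cong suc (sym eq) ⟩
      suc (length S + 0)    ≡⟨ +-suc (length S) 0 ⟨
      length S + 1          ≤⟨ +-monoʳ-≤ (length S) (s≤s z≤n) ⟩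
      length S + suc (length R) ≡⟨ length-++ S ⟨
      length (S ++ _ ∷ R)   ≡⟨ ↭-length M↭ ⟨
      length M              ∎))
      where open ≤-Reasoning
    branch-sound (suc r) S eq M↭ {w} {ws} w∈R w∈ws t
      with Equivalence.to T-∨ (All.lookup (all⁺ _ ws t) w∈ws)
    ... | inj₁ w∈S = contradiction w∈R (Unique-++-disjoint (Unique-resp-↭ M↭ M!) (∈ᵇ⇒∈ S w∈S))
    ... | inj₂ t₁ with R′ , R↭ ← extract w∈R =
      search-sound r (w ∷ S) (trans (sym (+-suc (length S) r)) eq)
        (↭-trans M↭ (↭-trans (++⁺ ↭-refl R↭) (shift w S R′))) t₁

  searchAll-sound : T searchAll → {M : List ℕ} → Unique M → (∀ {v} → v ∈ M → v < N) →
                    (∀ {A} → A ∈ E → hits A M ≢ 1) → length M ≤ 4 → M ≡ [] ⊎ length M ≡ 3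
  searchAll-sound t {[]}    _  _   _      _     = inj₁ refl
  searchAll-sound t {v ∷ M} M! M<N closed ∣M∣≤4 = inj₂
    (search-sound M! M<N ∣M∣≤4 closed 3 (v ∷ []) refl ↭-refl
      (All.lookup (all⁺ _ (upTo N) t) (∈-upTo⁺ (M<N (here refl)))))

-- Size 3 cannot be excluded: a vertex shared by two pendant edges is in a closed triple.
record Tight {n : ℕ} (E : List (Subset n)) : Set where
  field
    unique  : Unique E
    uniform : All (λ e → ∣ e ∣ ≡ 4) E
    closed  : ∀ S → (∀ {A} → A ∈ E → ∣ A ∩ S ∣ ≢ 1) → ∣ S ∣ ≤ 4 → ∣ S ∣ ≡ 0 ⊎ ∣ S ∣ ≡ 3

-- From lists of numbers to tight hypergraphs.

fromℕs : ∀ {n} → List ℕ → Subset n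
fromℕs xs = tabulate (λ v → toℕ v ∈ᵇ xs)

count-fromℕs : ∀ {n} A (S : Subset n) → ∣ fromℕs A ∩ S ∣ ≡ hits A (map toℕ (members S))
count-fromℕs A S = begin
  ∣ fromℕs A ∩ S ∣                       ≡⟨ ∣∩∣≡count (fromℕs A) S ⟩
  count (lookup (fromℕs A)) (members S)
    ≡⟨ cong sum (map-cong (λ v → cong (if_then 1 else 0) (lookup∘tabulate _ v)) (members S)) ⟩
  count (λ v → toℕ v ∈ᵇ A) (members S)   ≡⟨ cong sum (map-∘ (members S)) ⟩
  hits A (map toℕ (members S))           ∎
  where open ≡-Reasoning

search⇒Tight : ∀ {n} (E : List (List ℕ)) → T (Search.searchAll n E) →
  Unique (map (fromℕs {n}) E) → All (λ e → ∣ e ∣ ≡ 4) (map (fromℕs {n}) E) → Tight (map (fromℕs {n}) E)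
search⇒Tight {n} E t E! E₄ = record { unique = E! ; uniform = E₄ ; closed = λ S closed ∣S∣≤4 →
  let M = map toℕ (members S)
      ∣M∣≡∣S∣ = trans (length-map toℕ (members S)) (length-members S)
      result = Search.searchAll-sound n E t {M} (Unique-map⁺ toℕ-injective (members-unique S))
        (λ v∈M → let w , _ , v≡w = ∈-map⁻ toℕ v∈M in subst (_< n) (sym v≡w) (toℕ<n w))
        (λ {A} A∈E hit → closed (∈-map⁺ fromℕs A∈E) (trans (count-fromℕs A S) hit))
        (≤-trans (≤-reflexive ∣M∣≡∣S∣) ∣S∣≤4)
  in Sum.map (λ M≡[] → trans (sym ∣M∣≡∣S∣) (cong length M≡[])) (trans (sym ∣M∣≡∣S∣)) result }

-- Disjoint unions.

infixr 5 _⊎ᴴ_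
_⊎ᴴ_ : ∀ {m n} → List (Subset m) → List (Subset n) → List (Subset (m + n))
E ⊎ᴴ F = map (_++ᵥ ⊥) E ++ map (⊥ ++ᵥ_) F

∣++∣ : ∀ {m n} (p : Subset m) (q : Subset n) → ∣ p ++ᵥ q ∣ ≡ ∣ p ∣ + ∣ q ∣
∣++∣ []          q = refl
∣++∣ (true  ∷ p) q = cong suc (∣++∣ p q)
∣++∣ (false ∷ p) q = ∣++∣ p q

∣⊥∩∣≡0 : ∀ {n} (q : Subset n) → ∣ ⊥ ∩ q ∣ ≡ 0
∣⊥∩∣≡0 {n} q = trans (cong ∣_∣ (∩-zeroˡ q)) (∣⊥∣≡0 n)

∣p++⊥∩∣ : ∀ {m n} (A p : Subset m) (q : Subset n) → ∣ (A ++ᵥ ⊥) ∩ (p ++ᵥ q) ∣ ≡ ∣ A ∩ p ∣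
∣p++⊥∩∣ A p q = begin
  ∣ (A ++ᵥ ⊥) ∩ (p ++ᵥ q) ∣ ≡⟨ cong ∣_∣ (zipWith-++ _∧_ A ⊥ p q) ⟩
  ∣ (A ∩ p) ++ᵥ (⊥ ∩ q) ∣   ≡⟨ ∣++∣ (A ∩ p) (⊥ ∩ q) ⟩
  ∣ A ∩ p ∣ + ∣ ⊥ ∩ q ∣     ≡⟨ cong (∣ A ∩ p ∣ +_) (∣⊥∩∣≡0 q) ⟩
  ∣ A ∩ p ∣ + 0             ≡⟨ +-identityʳ _ ⟩
  ∣ A ∩ p ∣                 ∎
  where open ≡-Reasoning

∣⊥++q∩∣ : ∀ {m n} (A q : Subset n) (p : Subset m) → ∣ (⊥ ++ᵥ A) ∩ (p ++ᵥ q) ∣ ≡ ∣ A ∩ q ∣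
∣⊥++q∩∣ A q p = begin
  ∣ (⊥ ++ᵥ A) ∩ (p ++ᵥ q) ∣ ≡⟨ cong ∣_∣ (zipWith-++ _∧_ ⊥ A p q) ⟩
  ∣ (⊥ ∩ p) ++ᵥ (A ∩ q) ∣   ≡⟨ ∣++∣ (⊥ ∩ p) (A ∩ q) ⟩
  ∣ ⊥ ∩ p ∣ + ∣ A ∩ q ∣     ≡⟨ cong (_+ ∣ A ∩ q ∣) (∣⊥∩∣≡0 p) ⟩
  ∣ A ∩ q ∣                 ∎
  where open ≡-Reasoning

length-⊎ᴴ : ∀ {m n} (E : List (Subset m)) (F : List (Subset n)) → length (E ⊎ᴴ F) ≡ length E + length F
length-⊎ᴴ E F = trans (length-++ (map _ E)) (cong₂ _+_ (length-map _ E) (length-map _ F))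

⊎ᴴ-uniform : ∀ {m n} {E : List (Subset m)} {F : List (Subset n)} →
  All (λ e → ∣ e ∣ ≡ 4) E → All (λ e → ∣ e ∣ ≡ 4) F → All (λ e → ∣ e ∣ ≡ 4) (E ⊎ᴴ F)
⊎ᴴ-uniform {m} {n} E₄ F₄ = All-++⁺
  (All-map⁺ (All.map (λ {e} e₄ → trans (∣++∣ e ⊥) (cong₂ _+_ e₄ (∣⊥∣≡0 n))) E₄))
  (All-map⁺ (All.map (λ {e} e₄ → trans (∣++∣ (⊥ {m}) e) (cong₂ _+_ (∣⊥∣≡0 m) e₄)) F₄))

-- An edge from `E` has 4 vertices in the left part, one from `F` has none.
⊎ᴴ-unique : ∀ {m n} {E : List (Subset m)} {F : List (Subset n)} →
  All (λ e → ∣ e ∣ ≡ 4) E → Unique E → Unique F → Unique (E ⊎ᴴ F)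
⊎ᴴ-unique {m} E₄ E! F! = Unique-++⁺ (Unique-map⁺ (++-injectiveˡ _ _) E!) (Unique-map⁺ (++-injectiveʳ ⊥ ⊥) F!) disjoint
  where
  disjoint : ∀ {x} → ¬ (x ∈ map (_++ᵥ ⊥) _ × x ∈ map (⊥ ++ᵥ_) _)
  disjoint (x∈E , x∈F)
    with e , e∈ , refl ← ∈-map⁻ (_++ᵥ ⊥) x∈E
    with f , f∈ , eq ← ∈-map⁻ (⊥ ++ᵥ_) x∈F
    with () ← trans (sym (All.lookup E₄ e∈)) (trans (cong ∣_∣ (++-injectiveˡ e ⊥ eq)) (∣⊥∣≡0 m))

-- Both parts of a closed set are closed, so each has size 0 or 3, and 3 + 3 exceeds 4.
⊎ᴴ-Tight : ∀ {m n} {E : List (Subset m)} {F : List (Subset n)} → Tight E → Tight F → Tight (E ⊎ᴴ F)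
⊎ᴴ-Tight {m} {E = E} {F} tE tF = record
  { unique  = ⊎ᴴ-unique E.uniform E.unique F.unique
  ; uniform = ⊎ᴴ-uniform E.uniform F.uniform
  ; closed  = closed
  }
  where
  module E = Tight tE
  module F = Tight tF
  closed : ∀ S → (∀ {A} → A ∈ E ⊎ᴴ F → ∣ A ∩ S ∣ ≢ 1) → ∣ S ∣ ≤ 4 → ∣ S ∣ ≡ 0 ⊎ ∣ S ∣ ≡ 3
  closed S cl ∣S∣≤4 with p , q , refl ← splitAt m S rewrite ∣++∣ p q
    with E.closed p (λ {A} A∈ hit → cl (∈-++⁺ˡ (∈-map⁺ _ A∈)) (trans (∣p++⊥∩∣ A p q) hit)) (m+n≤o⇒m≤o ∣ p ∣ ∣S∣≤4)
       | F.closed q (λ {A} A∈ hit → cl (∈-++⁺ʳ (map _ E) (∈-map⁺ _ A∈)) (trans (∣⊥++q∩∣ A q p) hit)) (m+n≤o⇒n≤o ∣ p ∣ ∣S∣≤4)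
  ... | inj₁ p₀ | inj₁ q₀ = inj₁ (cong₂ _+_ p₀ q₀)
  ... | inj₁ p₀ | inj₂ q₃ = inj₂ (cong₂ _+_ p₀ q₃)
  ... | inj₂ p₃ | inj₁ q₀ = inj₂ (cong₂ _+_ p₃ q₀)
  ... | inj₂ p₃ | inj₂ q₃ with s≤s (s≤s (s≤s (s≤s ()))) ← subst (_≤ 4) (cong₂ _+_ p₃ q₃) ∣S∣≤4

∣p∣≡0⇒p≡⊥ : ∀ {n} (p : Subset n) → ∣ p ∣ ≡ 0 → p ≡ ⊥
∣p∣≡0⇒p≡⊥ []          _  = refl
∣p∣≡0⇒p≡⊥ (false ∷ p) p₀ = cong (false ∷_) (∣p∣≡0⇒p≡⊥ p p₀)

-- A closed 4-set has 0 or 3 vertices outside the isolated edge. With 3 it would meet that edge in a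
-- single vertex, so it has none there and is the isolated edge itself. Hence closed triples are
-- harmless in `Tight`.
withIsolatedEdge : ∀ {n} (E : List (Subset n)) → Tight E →
  ∃[ G ] (B4-semi-saturated {4 + n} G × size G ≡ 1 + length E)
withIsolatedEdge {n} E tE =
  record { edges = edge ⊎ᴴ E ; distinct = ⊎ᴴ-unique edge₄ ([] ∷ []) E.unique ; uniform = ⊎ᴴ-uniform edge₄ E.uniform }
  , semi-saturated , length-⊎ᴴ edge E
  where
  module E = Tight tE
  edge : List (Subset 4)
  edge = ⊤ ∷ []
  edge₄ : All (λ e → ∣ e ∣ ≡ 4) edge
  edge₄ = refl ∷ []
  semi-saturated : (S : Subset (4 + n)) → ∣ S ∣ ≡ 4 → S ∉ edge ⊎ᴴ E → ∃[ A ] (A ∈ edge ⊎ᴴ E × ∣ A ∩ S ∣ ≡ 1)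
  semi-saturated S S₄ S∉ with Any.any? (λ A → ∣ A ∩ S ∣ ≟ 1) (edge ⊎ᴴ E)
  ... | yes hit = find hit
  ... | no ¬hit with p , q , refl ← splitAt 4 S = contradiction (S∈ p≡⊤ q≡⊥) S∉
    where
    p+q : ∣ p ∣ + ∣ q ∣ ≡ 4
    p+q = trans (sym (∣++∣ p q)) S₄
    cl : ∀ {A} → A ∈ edge ⊎ᴴ E → ∣ A ∩ (p ++ᵥ q) ∣ ≢ 1
    cl A∈ hit = ¬hit (lose A∈ hit)
    p≢1 : ∣ p ∣ ≢ 1
    p≢1 p₁ = cl (here refl) (trans (∣p++⊥∩∣ ⊤ p q) (trans (cong ∣_∣ (∩-identityˡ p)) p₁))
    q₀ : ∣ q ∣ ≡ 0
    q₀ with E.closed q (λ {A} A∈ hit → cl (there (∈-map⁺ _ A∈)) (trans (∣⊥++q∩∣ A q p) hit))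
                     (≤-trans (m≤n+m ∣ q ∣ ∣ p ∣) (≤-reflexive p+q))
    ... | inj₁ q₀ = q₀
    ... | inj₂ q₃ = contradiction (+-cancelʳ-≡ 3 ∣ p ∣ 1 (trans (cong (∣ p ∣ +_) (sym q₃)) p+q)) p≢1
    q≡⊥ : q ≡ ⊥
    q≡⊥ = ∣p∣≡0⇒p≡⊥ q q₀
    p≡⊤ : p ≡ ⊤
    p≡⊤ = ∣p∣≡n⇒p≡⊤ (trans (sym (+-identityʳ ∣ p ∣)) (trans (cong (∣ p ∣ +_) (sym q₀)) p+q))
    S∈ : p ≡ ⊤ → q ≡ ⊥ → p ++ᵥ q ∈ edge ⊎ᴴ E
    S∈ refl refl = here refl

-- Vertex j of block i, for 0 ≤ j < 13, is numbered 13 i + j.  In each block the first two edges are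
-- pendant (at vertices 0 and 1) and share vertex 2; the other four edges meet pairwise, with the
-- shifts 1, 1, 2, 2, 1, 2 along the ring of blocks, in vertices 7 to 12.
block : (k : ℕ) .{{_ : NonZero k}} → ℕ → List (List ℕ)
block k i = (v 0 0 ∷ v 2 0 ∷ v 3 0 ∷ v 4 0 ∷ [])
          ∷ (v 1 0 ∷ v 2 0 ∷ v 5 0 ∷ v 6 0 ∷ [])
          ∷ (v 3 0 ∷ v 7 0 ∷ v 8 0 ∷ v 9 0 ∷ [])
          ∷ (v 4 0 ∷ v 7 1 ∷ v 10 0 ∷ v 11 0 ∷ [])
          ∷ (v 5 0 ∷ v 8 1 ∷ v 10 2 ∷ v 12 0 ∷ [])
          ∷ (v 6 0 ∷ v 9 2 ∷ v 11 1 ∷ v 12 2 ∷ [])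
          ∷ []
  where
  v : ℕ → ℕ → ℕ
  v j d = ((i + d) % k) * 13 + j

ring : (k : ℕ) .{{_ : NonZero k}} → List (List ℕ)
ring k = concatMap (block k) (upTo k)

ring-Tight : ∀ k .{{_ : NonZero k}} → T (Search.searchAll (k * 13) (ring k)) →
  {_ : True (unique? _≟ₛ_ (map (fromℕs {k * 13}) (ring k)))} →
  {_ : True (all? (λ e → ∣ e ∣ ≟ 4) (map (fromℕs {k * 13}) (ring k)))} →
  Tight (map (fromℕs {k * 13}) (ring k))
ring-Tight k t {u} {a} = search⇒Tight (ring k) t (toWitness u) (toWitness a)

-- Tight hypergraphs with 13k vertices and 6k edges.

record TightOf (k : ℕ) : Set where
  constructor tightOf
  field
    {edgeSet} : List (Subset (k * 13))
    tight     : Tight edgeSet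
    6-edges   : length edgeSet ≡ k * 6

_⊕_ : ∀ {j k} → TightOf j → TightOf k → TightOf (j + k)
_⊕_ {j} {k} (tightOf {E} tE E₆) (tightOf {F} tF F₆) =
  let G , tG , G₆ = subst (λ n → ∃[ G ] (Tight {n} G × length G ≡ (j + k) * 6)) (sym (*-distribʳ-+ 13 j k))
        (E ⊎ᴴ F , ⊎ᴴ-Tight tE tF , trans (length-⊎ᴴ E F) (trans (cong₂ _+_ E₆ F₆) (sym (*-distribʳ-+ 6 j k))))
  in tightOf tG G₆

-- The `_` stands for the evaluated search: once it computes to `true`, its `T` is the unit type.
ring₄ : TightOf 4
ring₄ = tightOf (ring-Tight 4 _) refl

ring₅ : TightOf 5
ring₅ = tightOf (ring-Tight 5 _) refl

ring₆ : TightOf 6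
ring₆ = tightOf (ring-Tight 6 _) refl

-- Sums of two of 4, 5 and 6 give the four consecutive values 8 to 11, and further copies of 4 give
-- the rest.
rings : ∀ k → TightOf (8 + k)
rings 0 = ring₄ ⊕ ring₄
rings 1 = ring₄ ⊕ ring₅
rings 2 = ring₅ ⊕ ring₅
rings 3 = ring₅ ⊕ ring₆
rings (suc (suc (suc (suc k)))) = ring₄ ⊕ rings k

extremal : (n : ℕ) → 100 ≤ n → n % 13 ≡ 4 → ∃[ G ] (B4-semi-saturated {n} G × 13 * size G + 11 ≡ 6 * n)
extremal n 100≤n n≡4 = subst (λ n → ∃[ G ] (B4-semi-saturated {n} G × 13 * size G + 11 ≡ 6 * n)) (sym n≡)
  (let G , G-sat , ∣G∣ = withIsolatedEdge edgeSet tight in G , G-sat , (begin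
    13 * size G + 11                 ≡⟨ cong (λ m → 13 * m + 11) (trans ∣G∣ (cong suc 6-edges)) ⟩
    13 * suc ((8 + k) * 6) + 11      ≡⟨ edge-count k ⟩
    6 * (4 + (8 + k) * 13)           ∎))
  where
  open ≡-Reasoning
  q = n / 13
  n≡4+13q : n ≡ 4 + q * 13
  n≡4+13q = trans (m≡m%n+[m/n]*n n 13) (cong (_+ q * 13) n≡4)
  -- With `q` at most 7, `n` would be at most 4 + 7 · 13 = 95.
  8≤q : 8 ≤ q
  8≤q = ≮⇒≥ λ q<8 → from-no (100 ≤? 95)
    (≤-trans 100≤n (≤-trans (≤-reflexive n≡4+13q) (+-monoʳ-≤ 4 (*-monoˡ-≤ 13 {q} {7} (s≤s⁻¹ q<8)))))
  k = q ∸ 8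
  n≡ : n ≡ 4 + (8 + k) * 13
  n≡ = trans n≡4+13q (cong (λ q → 4 + q * 13) {q} {8 + k} (sym (m+[n∸m]≡n 8≤q)))
  open TightOf (rings k)
  edge-count : ∀ k → 13 * suc ((8 + k) * 6) + 11 ≡ 6 * (4 + (8 + k) * 13)
  edge-count = solve-∀

theorem2p2 : ((n : ℕ) → 100 ≤ n → (G : Hypergraph4 n) → B4-semi-saturated G →
    6 * n ≤ 13 * size G + 11)
    × ((n : ℕ) → 100 ≤ n → n % 13 ≡ 4 →
    ∃[ G ] (B4-semi-saturated {n} G × 13 * size G + 11 ≡ 6 * n))
theorem2p2 = (λ n 100≤n G sat → LowerBound.lower-bound G sat 100≤n) , extremal
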